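{- Let $P$ be a set of $n$ points in the plane in general position (no three collinear) and let $x\in P$. Then $$\Delta(x,P)\le V_P(x)+H\bigl(V_P(x),K_3,K_4\setminus\{e\}\bigr).$$ Moreover, there exists a constant $C>0$ (independent of $n$) such that for every positive integer $n$ there exist a set $P$ of $n$ points in the plane in general position and a point $x\in P$ with $\Delta(x,P)\ge C\,V_P(x)^{3/2}$.
   Context: For a finite point set $Q$ in the plane in general position, an empty triangle of $Q$ is a triangle with vertices in $Q$ whose interior contains no point of $Q$; $N_\triangle(Q)$ denotes the number of empty triangles of $Q$. For $x\in P$, $\Delta(x,P)=|N_\triangle(P)-N_\triangle(P\setminus\{x\})|$, and $V_P(x)$ is the number of empty triangles of $P$ having $x$ as a vertex. The kite graph $K_4\setminus\{e\}$ is the complete graph $K_4$ with one edge removed. For a positive integer $m$, $H(m,K_3,K_4\setminus\{e\})$ denotes the maximum number of triangles in a graph on $m$ vertices that contains no subgraph isomorphic to $K_4\setminus\{e\}$. -}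

module Defs where

open import Level using (Level; _⊔_) renaming (suc to lsuc)
open import Data.Bool using (Bool; true; false; _∧_; not)
open import Data.Nat as ℕ using (ℕ; zero; suc; _^_; ∣_-_∣)
open import Data.Fin using (Fin; toℕ)
open import Data.Fin.Properties using () renaming (_≟_ to _≟ᶠ_)
open import Data.List using (List; map; allFin)
open import Data.Nat.ListAction using (sum)
open import Data.List.Relation.Unary.All using (All; all?)

open import Data.Product using (Σ; ∃; ∃-syntax; _×_; _,_)
open import Data.Sum using (_⊎_)
open import Relation.Nullary using (¬_; Dec; yes; no; does; _×-dec_; _⊎-dec_; ¬?)
open import Relation.Binary using (IsStrictTotalOrder)
open import Relation.Binary.PropositionalEquality using (_≡_)
open import Algebra.Bundles using (CommutativeRing)

-- Ordered fields (the plane is F × F for an ordered field F; the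
-- statement is proved for every ordered field, in particular for ℝ).

record OrderedField (c ℓ₁ ℓ₂ : Level) : Set (lsuc (c ⊔ ℓ₁ ⊔ ℓ₂)) where
  field
    commutativeRing : CommutativeRing c ℓ₁
  open CommutativeRing commutativeRing public
  field
    _<_              : Carrier → Carrier → Set ℓ₂
    isStrictTotalOrder : IsStrictTotalOrder _≈_ _<_
    +-mono-<         : ∀ {x y} z → x < y → (x + z) < (y + z)
    *-pos            : ∀ {x y} → 0# < x → 0# < y → 0# < (x * y)
    0≉1              : ¬ (0# ≈ 1#)
    inverse          : ∀ x → ¬ (x ≈ 0#) → ∃[ y ] ((x * y) ≈ 1#)
  open IsStrictTotalOrder isStrictTotalOrder public
    using () renaming (_<?_ to _<?_; _≟_ to _≟F_)

module Geometry {c ℓ₁ ℓ₂} (F : OrderedField c ℓ₁ ℓ₂) where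
  open OrderedField F

  Point : Set c
  Point = Carrier × Carrier

  px py : Point → Carrier
  px (a , _) = a
  py (_ , b) = b

  -- orientation determinant of (a, b, c): (b - a) × (c - a)
  orient : Point → Point → Point → Carrier
  orient a b c' = ((px b - px a) * (py c' - py a)) - ((py b - py a) * (px c' - px a))

  GeneralPosition : ∀ {n} → (Fin n → Point) → Set (ℓ₁)
  GeneralPosition {n} P =
    (∀ i j → px (P i) ≈ px (P j) → py (P i) ≈ py (P j) → i ≡ j) ×
    (∀ i j k → ¬ (i ≡ j) → ¬ (i ≡ k) → ¬ (j ≡ k) → ¬ (orient (P i) (P j) (P k) ≈ 0#))

  InTriangle : Point → Point → Point → Point → Set ℓ₂
  InTriangle a b c' p =
    (0# < orient a b p × 0# < orient b c' p × 0# < orient c' a p) ⊎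
    (orient a b p < 0# × orient b c' p < 0# × orient c' a p < 0#)

  inTriangle? : ∀ a b c' p → Dec (InTriangle a b c' p)
  inTriangle? a b c' p =
    (0# <? orient a b p ×-dec 0# <? orient b c' p ×-dec 0# <? orient c' a p) ⊎-dec
    (orient a b p <? 0# ×-dec orient b c' p <? 0# ×-dec orient c' a p <? 0#)

  EmptyIn : ∀ {n} → (Fin n → Point) → (Fin n → Bool) → Fin n → Fin n → Fin n → Set ℓ₂
  EmptyIn {n} P S i j k =
    All (λ l → S l ≡ true → ¬ InTriangle (P i) (P j) (P k) (P l)) (allFin n)

  emptyIn? : ∀ {n} P S i j k → Dec (EmptyIn {n} P S i j k)
  emptyIn? {n} P S i j k = all? (λ l → dec (S l)) (allFin n)
    where
    dec : ∀ {l} (b : Bool) → Dec (b ≡ true → ¬ InTriangle (P i) (P j) (P k) (P l))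
    dec {l} false = yes (λ ())
    dec {l} true with inTriangle? (P i) (P j) (P k) (P l)
    ... | yes q = no (λ f → f _≡_.refl q)
    ... | no ¬q = yes (λ _ → ¬q)

  countTriples : ∀ n → (Fin n → Fin n → Fin n → Bool) → ℕ
  countTriples n t =
    sum (map (λ i → sum (map (λ j → sum (map (λ k →
      ind (does (toℕ i ℕ.<? toℕ j) ∧ does (toℕ j ℕ.<? toℕ k) ∧ t i j k))
      (allFin n))) (allFin n))) (allFin n))
    where
    ind : Bool → ℕ
    ind true  = 1
    ind false = 0

  Nempty : ∀ {n} → (Fin n → Point) → (Fin n → Bool) → ℕ
  Nempty {n} P S = countTriples n (λ i j k →
    S i ∧ S j ∧ S k ∧ does (emptyIn? P S i j k))

  allOf : ∀ {n} → Fin n → Bool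
  allOf _ = true

  without : ∀ {n} → Fin n → Fin n → Bool
  without x l = not (does (l ≟ᶠ x))

  N△ : ∀ {n} → (Fin n → Point) → ℕ
  N△ P = Nempty P allOf

  Δ : ∀ {n} → (Fin n → Point) → Fin n → ℕ
  Δ P x = ∣ N△ P - Nempty P (without x) ∣

  V : ∀ {n} → (Fin n → Point) → Fin n → ℕ
  V {n} P x = countTriples n (λ i j k →
    (does (i ≟ᶠ x) Data.Bool.∨ does (j ≟ᶠ x) Data.Bool.∨ does (k ≟ᶠ x)) ∧
    does (emptyIn? P allOf i j k))

record Graph (m : ℕ) : Set where
  field
    adj  : Fin m → Fin m → Bool
    sym  : ∀ i j → adj i j ≡ adj j i
    irr  : ∀ i → adj i i ≡ false
open Graph public

triangles : ∀ {m} → Graph m → ℕ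
triangles {m} G = sum (map (λ i → sum (map (λ j → sum (map (λ k →
    ind (does (toℕ i ℕ.<? toℕ j) ∧ does (toℕ j ℕ.<? toℕ k) ∧
         adj G i j ∧ adj G j k ∧ adj G i k))
    (allFin m))) (allFin m))) (allFin m))
  where
  ind : Bool → ℕ
  ind true  = 1
  ind false = 0

-- G contains a (not necessarily induced) subgraph isomorphic to K₄ \ {e}:
-- four distinct vertices a b c d with edges ab, ac, bc, ad, bd (cd may be missing)
ContainsKite : ∀ {m} → Graph m → Set
ContainsKite {m} G = ∃[ a ] ∃[ b ] ∃[ c ] ∃[ d ]
  (¬ a ≡ b × ¬ a ≡ c × ¬ a ≡ d × ¬ b ≡ c × ¬ b ≡ d × ¬ c ≡ d) ×
  (adj G a b ≡ true × adj G a c ≡ true × adj G b c ≡ true ×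
   adj G a d ≡ true × adj G b d ≡ true)

IsH : ℕ → ℕ → Set
IsH m h =
  (∃[ G ] (¬ ContainsKite {m} G × triangles G ≡ h)) ×
  (∀ (G : Graph m) → ¬ ContainsKite G → triangles G ℕ.≤ h)

{-# OPTIONS --safe #-}
module Submission where

-- Deleting x destroys the V empty triangles at x and creates the T triangles whose only interior
-- point is x, so Δ = |V − T|. Direct the side opposite x of each empty triangle at x so that x is on
-- its left. If x is the only point inside abc, then xab, xbc and xca are empty, so abc is a directed
-- 3-cycle on these V arcs. Join two arcs when they are consecutive sides of a directed 3-cycle: two
-- consecutive arcs determine the third side, so every edge lies in exactly one triangle. The graph is
-- therefore kite-free, and T ≤ H(V).
--
-- For the lower bound take n points on a parabola and let x be a point above it, chosen so that x
-- lies in every triangle with one vertex in each of three blocks of k ≈ n / 7 consecutive points.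
-- Points on a parabola are in convex position, so T ≥ k³, while V ≤ (n + 1)² ≤ 64 k². For k ≥ 128
-- this gives Δ ≥ k³ / 2 and V³ ≤ 1024² Δ². For smaller n the blocks are empty and T = 0, so Δ = V
-- and V ≤ 1024² suffices.

open import Defs
open import Level using (Level)
open import Data.Nat using (ℕ; _≤_; _+_; _^_; suc)
open import Data.Fin using (Fin)
open import Data.Product using (_×_; ∃-syntax)
open import Data.Rational using (ℚ; 0ℚ; _/_) renaming (_≤_ to _≤ℚ_; _<_ to _<ℚ_; _*_ to _*ℚ_)
open import Data.Integer using (+_)

open import Algebra.Bundles using (RawRing)
import Algebra.Properties.AbelianGroup
import Algebra.Properties.CommutativeSemigroup
import Algebra.Properties.Group
import Algebra.Properties.Ring
import Algebra.Properties.Semiring.Mult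
import Algebra.Solver.Ring
open import Algebra.Solver.Ring.AlmostCommutativeRing
  using (fromCommutativeRing; _-Raw-AlmostCommutative⟶_)
open import Data.Bool using (Bool; true; false; _∧_; _∨_; not)
import Data.Bool.Properties as Bool
open import Data.Empty using (⊥; ⊥-elim)
open import Data.Fin using (zero; suc; toℕ)
import Data.Fin.Properties as Fin
open import Data.Fin.Properties using () renaming (_≟_ to _≟ᶠ_)
import Data.Integer as ℤ
import Data.Integer.Properties as ℤ
open import Data.List
  using (List; []; _∷_; map; allFin; tabulate; filter; cartesianProduct; length; lookup)
import Data.List.Properties as List
open import Data.List.Membership.Propositional.Properties using (∈-lookup; ∈-allFin)
open import Data.List.Relation.Unary.All as All using (All)
import Data.List.Relation.Unary.All.Properties as All
open import Data.List.Relation.Unary.AllPairs using (_∷_)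
open import Data.List.Relation.Unary.Unique.Propositional using (Unique)
import Data.List.Relation.Unary.Unique.Propositional.Properties as Unique
open import Data.Maybe using (Maybe; just; nothing)
open import Data.Nat as ℕ using (zero; _*_; z≤n; s≤s; ∣_-_∣)
open import Data.Nat.DivMod using (m/n*n≤m; m≡m%n+[m/n]*n; m%n<n)
open import Data.Nat.ListAction using () renaming (sum to sumᴸ)
open import Data.Nat.ListAction.Properties using (sum-++)
import Data.Nat.Properties as ℕ
open import Algebra.Properties.Semiring.Sum ℕ.+-*-semiring
  using (sum; ∑-comm; ∑-distrib-+; sum-cong-≗; *-distribˡ-sum)
open import Data.Nat.Tactic.RingSolver using (solve-∀)
open import Data.Product using (_,_; proj₁; proj₂; uncurry)
open import Data.Rational using (toℚᵘ; *<*)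
import Data.Rational.Properties as ℚ
import Data.Rational.Unnormalised as ℚᵘ
import Data.Rational.Unnormalised.Properties as ℚᵘ
open import Data.Sum using (_⊎_; inj₁; inj₂)
open import Function using (_∘_)
open import Relation.Binary using (IsStrictTotalOrder; Tri; tri<; tri≈; tri>)
open import Relation.Binary.PropositionalEquality as ≡
  using (_≡_; refl; trans; cong; cong₂; subst; subst₂)
open import Relation.Nullary using (¬_; Dec; yes; no; does)
open import Relation.Nullary.Decidable using (dec-true; dec-false; decidable-stable)

-- Ordered fields: a ring solver and rules for signs.

module Field {c ℓ₁ ℓ₂} (F : OrderedField c ℓ₁ ℓ₂) where
  open OrderedField F hiding (zero)
    renaming ( _<_ to infix 4 _<_; _+_ to _+ᶠ_; _*_ to _*ᶠ_; _-_ to _-ᶠ_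
             ; refl to ≈-refl; sym to ≈-sym; trans to ≈-trans)
  open Algebra.Properties.Ring ring
  open Algebra.Properties.AbelianGroup +-abelianGroup using (⁻¹-∙-comm)
  open Algebra.Properties.Semiring.Mult semiring using (×-homo-+; ×1-homo-*; ×-homo-1)
    renaming (_×_ to _×'_)
  open Algebra.Properties.CommutativeSemigroup +-commutativeSemigroup using (interchange)
  open import Relation.Binary.Reasoning.Setoid setoid

  ι : ℕ → Carrier
  ι n = n ×' 1#

  -- Coefficients for the ring solver: the pair (a , b) stands for the integer a − b.
  differences : RawRing _ _
  differences = record
    { Carrier = ℕ × ℕ
    ; _≈_ = _≡_
    ; _+_ = λ (a , b) (a' , b') → a ℕ.+ a' , b ℕ.+ b'
    ; _*_ = λ (a , b) (a' , b') → a ℕ.* a' ℕ.+ b ℕ.* b' , a ℕ.* b' ℕ.+ b ℕ.* a'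
    ; -_  = λ (a , b) → b , a
    ; 0#  = 0 , 0
    ; 1#  = 1 , 0
    }

  ⟦_⟧ᵈ : ℕ × ℕ → Carrier
  ⟦ a , b ⟧ᵈ = ι a -ᶠ ι b

  sub-cong : ∀ {x y z w} → x ≈ y → z ≈ w → x -ᶠ z ≈ y -ᶠ w
  sub-cong p q = +-cong p (-‿cong q)

  +-sub : ∀ x y z w → (x +ᶠ z) -ᶠ (y +ᶠ w) ≈ (x -ᶠ y) +ᶠ (z -ᶠ w)
  +-sub x y z w = ≈-trans (+-congˡ (≈-sym (⁻¹-∙-comm y w))) (interchange x z (- y) (- w))

  ι-+ : ∀ m n → ι (m ℕ.+ n) ≈ ι m +ᶠ ι n
  ι-+ m n = ×-homo-+ 1# m n

  ι-* : ∀ m n → ι (m ℕ.* n) ≈ ι m *ᶠ ι n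
  ι-* = ×1-homo-*

  *-sub : ∀ x y z w → (x *ᶠ z +ᶠ y *ᶠ w) -ᶠ (x *ᶠ w +ᶠ y *ᶠ z) ≈ (x -ᶠ y) *ᶠ (z -ᶠ w)
  *-sub x y z w = ≈-sym (begin
    (x -ᶠ y) *ᶠ (z -ᶠ w)                                           ≈⟨ distribʳ (z -ᶠ w) x (- y) ⟩
    x *ᶠ (z -ᶠ w) +ᶠ - y *ᶠ (z -ᶠ w)                               ≈⟨ +-cong (distribˡ x z (- w)) (distribˡ (- y) z (- w)) ⟩
    (x *ᶠ z +ᶠ x *ᶠ - w) +ᶠ (- y *ᶠ z +ᶠ - y *ᶠ - w)               ≈⟨ +-congˡ (+-comm _ _) ⟩
    (x *ᶠ z +ᶠ x *ᶠ - w) +ᶠ (- y *ᶠ - w +ᶠ - y *ᶠ z)               ≈⟨ interchange _ _ _ _ ⟩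
    (x *ᶠ z +ᶠ - y *ᶠ - w) +ᶠ (x *ᶠ - w +ᶠ - y *ᶠ z)
      ≈⟨ +-cong (+-congˡ (≈-trans (≈-sym (-‿distribˡ-* y (- w)))
           (≈-trans (-‿cong (≈-sym (-‿distribʳ-* y w))) (-‿involutive _))))
           (+-cong (≈-sym (-‿distribʳ-* x w)) (≈-sym (-‿distribˡ-* y z))) ⟩
    (x *ᶠ z +ᶠ y *ᶠ w) +ᶠ (- (x *ᶠ w) +ᶠ - (y *ᶠ z))               ≈⟨ +-congˡ (⁻¹-∙-comm _ _) ⟩
    (x *ᶠ z +ᶠ y *ᶠ w) -ᶠ (x *ᶠ w +ᶠ y *ᶠ z)                       ∎)

  private
    evaluation : differences -Raw-AlmostCommutative⟶ fromCommutativeRing commutativeRing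
    evaluation = record
      { ⟦_⟧    = ⟦_⟧ᵈ
      ; +-homo = λ (a , b) (a' , b') →
          ≈-trans (sub-cong (ι-+ a a') (ι-+ b b')) (+-sub _ _ _ _)
      ; *-homo = λ (a , b) (a' , b') → ≈-trans
          (sub-cong (≈-trans (ι-+ (a ℕ.* a') _) (+-cong (ι-* a a') (ι-* b b')))
                    (≈-trans (ι-+ (a ℕ.* b') _) (+-cong (ι-* a b') (ι-* b a'))))
          (*-sub _ _ _ _)
      ; -‿homo = λ (a , b) → ≈-sym (≈-trans (≈-sym (⁻¹-∙-comm _ _))
          (≈-trans (+-comm _ _) (+-congʳ (-‿involutive _))))
      ; 0-homo = -‿inverseʳ _
      ; 1-homo = ≈-trans (+-cong (×-homo-1 1#) ε⁻¹≈ε) (+-identityʳ 1#)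
      }
      where open Algebra.Properties.AbelianGroup +-abelianGroup using (ε⁻¹≈ε)

    -- One integer has many representations as a difference, so the test is `a + b' ≡ a' + b` rather
    -- than equality of pairs.
    _≟ᵈ_ : ∀ p q → Maybe (⟦ p ⟧ᵈ ≈ ⟦ q ⟧ᵈ)
    (a , b) ≟ᵈ (a' , b') with (a ℕ.+ b') ℕ.≟ (a' ℕ.+ b)
    ... | no _  = nothing
    ... | yes e = just (begin
      ι a -ᶠ ι b                       ≈⟨ +-identityʳ _ ⟨
      (ι a -ᶠ ι b) +ᶠ 0#               ≈⟨ +-congˡ (-‿inverseʳ (ι b')) ⟨
      (ι a -ᶠ ι b) +ᶠ (ι b' -ᶠ ι b')   ≈⟨ +-sub _ _ _ _ ⟨
      (ι a +ᶠ ι b') -ᶠ (ι b +ᶠ ι b')   ≈⟨ sub-cong (≈-trans (≈-sym (ι-+ a b'))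
          (≈-trans (reflexive (cong ι e)) (ι-+ a' b))) (+-comm _ _) ⟩
      (ι a' +ᶠ ι b) -ᶠ (ι b' +ᶠ ι b)   ≈⟨ +-sub _ _ _ _ ⟩
      (ι a' -ᶠ ι b') +ᶠ (ι b -ᶠ ι b)   ≈⟨ +-congˡ (-‿inverseʳ (ι b)) ⟩
      (ι a' -ᶠ ι b') +ᶠ 0#             ≈⟨ +-identityʳ _ ⟩
      ι a' -ᶠ ι b'                     ∎)

  open Algebra.Solver.Ring differences (fromCommutativeRing commutativeRing) evaluation _≟ᵈ_
    public using (solve; _:=_; _:+_; _:*_; _:-_; :-_)

  open IsStrictTotalOrder isStrictTotalOrder public
    using (compare) renaming (trans to <-trans; irrefl to <-irrefl; asym to <-asym)
  open IsStrictTotalOrder isStrictTotalOrder using (<-resp-≈)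

  <-respʳ : ∀ {x y z} → y ≈ z → x < y → x < z
  <-respʳ = proj₁ <-resp-≈

  <-respˡ : ∀ {x y z} → y ≈ z → y < x → z < x
  <-respˡ = proj₂ <-resp-≈

  <-resp : ∀ {x y z w} → x ≈ y → z ≈ w → x < z → y < w
  <-resp p q r = <-respˡ p (<-respʳ q r)

  +-pos : ∀ {x y} → 0# < x → 0# < y → 0# < x +ᶠ y
  +-pos {x} {y} p q = <-trans q (<-respˡ (+-identityˡ y) (+-mono-< y p))

  neg-pos : ∀ {x} → x < 0# → 0# < - x
  neg-pos {x} p = <-resp (-‿inverseʳ x) (+-identityˡ _) (+-mono-< (- x) p)

  neg-neg : ∀ {x} → 0# < x → - x < 0#
  neg-neg {x} p = <-resp (+-identityˡ _) (-‿inverseʳ x) (+-mono-< (- x) p)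

  *-pos-neg : ∀ {x y} → 0# < x → y < 0# → x *ᶠ y < 0#
  *-pos-neg {x} {y} p q = <-respˡ (≈-trans (-‿cong (≈-sym (-‿distribʳ-* x y))) (-‿involutive _))
    (neg-neg (*-pos p (neg-pos q)))

  *-cancel-pos : ∀ {x y} → 0# < x → 0# < x *ᶠ y → 0# < y
  *-cancel-pos {x} {y} p q with compare 0# y
  ... | tri< l _ _ = l
  ... | tri≈ _ e _ = ⊥-elim (<-irrefl (≈-sym (≈-trans (*-congˡ (≈-sym e)) (zeroʳ x))) q)
  ... | tri> _ _ g = ⊥-elim (<-asym q (*-pos-neg p g))

  sub-pos : ∀ {x y} → x < y → 0# < y -ᶠ x
  sub-pos {x} {y} p = <-respˡ (-‿inverseʳ x) (+-mono-< (- x) p)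

  0<1 : 0# < 1#
  0<1 with compare 0# 1#
  ... | tri< l _ _ = l
  ... | tri≈ _ e _ = ⊥-elim (0≉1 e)
  ... | tri> _ _ g = <-respʳ (≈-trans (-1*x≈-x (- 1#)) (-‿involutive 1#)) (*-pos (neg-pos g) (neg-pos g))

  ι-pos : ∀ n → 0# < ι (suc n)
  ι-pos zero    = <-respʳ (≈-sym (×-homo-1 1#)) 0<1
  ι-pos (suc n) = +-pos 0<1 (ι-pos n)

  ι-mono : ∀ {m n} → m ℕ.< n → ι m < ι n
  ι-mono {m} {suc n} (ℕ.s≤s m≤n) = <-resp (+-identityˡ _)
    (≈-trans (≈-sym (ι-+ (suc (n ℕ.∸ m)) m)) (reflexive (cong (λ z → ι (suc z)) (ℕ.m∸n+n≡m m≤n))))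
    (+-mono-< (ι m) (ι-pos (n ℕ.∸ m)))

  ι-injective : ∀ {m n} → ι m ≈ ι n → m ≡ n
  ι-injective {m} {n} e with ℕ.<-cmp m n
  ... | tri< l _ _ = ⊥-elim (<-irrefl e (ι-mono l))
  ... | tri≈ _ p _ = p
  ... | tri> _ _ g = ⊥-elim (<-irrefl (≈-sym e) (ι-mono g))

-- Orientation determinants and nested triangles.

module Plane {c ℓ₁ ℓ₂} (F : OrderedField c ℓ₁ ℓ₂) where
  open OrderedField F hiding (zero)
    renaming ( _<_ to infix 4 _<_; _+_ to _+ᶠ_; _*_ to _*ᶠ_; _-_ to _-ᶠ_
             ; refl to ≈-refl; sym to ≈-sym; trans to ≈-trans)
  open Geometry F
  open Field F

  orient-swap : ∀ a b d → orient b a d ≈ - orient a b d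
  orient-swap (a , a') (b , b') (d , d') = solve 6 (λ a a' b b' d d' →
    (a :- b) :* (d' :- b') :- (a' :- b') :* (d :- b) :=
    :- ((b :- a) :* (d' :- a') :- (b' :- a') :* (d :- a))) ≈-refl a a' b b' d d'

  orient-rotate : ∀ a b d → orient b d a ≈ orient a b d
  orient-rotate (a , a') (b , b') (d , d') = solve 6 (λ a a' b b' d d' →
    (d :- b) :* (a' :- b') :- (d' :- b') :* (a :- b) :=
    (b :- a) :* (d' :- a') :- (b' :- a') :* (d :- a)) ≈-refl a a' b b' d d'

  orient-aab : ∀ a b → orient a a b ≈ 0#
  orient-aab (a , a') (b , b') = ≈-trans (solve 4 (λ a a' b b' →
    (a :- a) :* (b' :- a') :- (a' :- a') :* (b :- a) := a :- a) ≈-refl a a' b b') (-‿inverseʳ a)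

  orient-aba : ∀ a b → orient a b a ≈ 0#
  orient-aba a b = ≈-trans (orient-rotate a a b) (orient-aab a b)

  -- Doubled signed areas: the triangle `xab` is cut from `y` along its three sides.
  orient-split : ∀ x a b y → (orient x a y +ᶠ orient a b y) +ᶠ orient b x y ≈ orient a b x
  orient-split (x , x') (a , a') (b , b') (y , y') = solve 8 (λ x x' a a' b b' y y' →
    (((a :- x) :* (y' :- x') :- (a' :- x') :* (y :- x)) :+
     ((b :- a) :* (y' :- a') :- (b' :- a') :* (y :- a))) :+
    ((x :- b) :* (y' :- b') :- (x' :- b') :* (y :- b)) :=
    ((b :- a) :* (x' :- a') :- (b' :- a') :* (x :- a))) ≈-refl x x' a a' b b' y y'

  -- y is the barycentric combination of a, b, x with weights orient b x y, orient x a y, orient a b y,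
  -- and orient b d vanishes at b.
  barycentric : ∀ x a b d y → orient a b x *ᶠ orient b d y ≈
    orient a b y *ᶠ orient b d x +ᶠ orient b x y *ᶠ orient b d a
  barycentric (x , x') (a , a') (b , b') (d , d') (y , y') = solve 10 (λ x x' a a' b b' d d' y y' →
    let o = λ p p' q q' r r' → (q :- p) :* (r' :- p') :- (q' :- p') :* (r :- p) in
    o a a' b b' x x' :* o b b' d d' y y' :=
    o a a' b b' y y' :* o b b' d d' x x' :+ o b b' x x' y y' :* o b b' d d' a a')
    ≈-refl x x' a a' b b' d d' y y'

  -- The same expansion for `orient d a`, which vanishes at `a`, so the weights of `x` and `b`
  -- survive.
  barycentric′ : ∀ x a b d y → orient a b x *ᶠ orient d a y ≈
    orient a b y *ᶠ orient d a x +ᶠ orient x a y *ᶠ orient d a b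
  barycentric′ (x , x') (a , a') (b , b') (d , d') (y , y') = solve 10 (λ x x' a a' b b' d d' y y' →
    let o = λ p p' q q' r r' → (q :- p) :* (r' :- p') :- (q' :- p') :* (r :- p) in
    o a a' b b' x x' :* o d d' a a' y y' :=
    o a a' b b' y y' :* o d d' a a' x x' :+ o x x' a a' y y' :* o d d' a a' b b')
    ≈-refl x x' a a' b b' d d' y y'

  inTriangle-rotate : ∀ {a b d p} → InTriangle a b d p → InTriangle b d a p
  inTriangle-rotate (inj₁ (u , v , w)) = inj₁ (v , w , u)
  inTriangle-rotate (inj₂ (u , v , w)) = inj₂ (v , w , u)

  degenerate : ∀ {a b p} → ¬ InTriangle a a b p
  degenerate {a} {b} {p} (inj₁ (q , _)) = <-irrefl (≈-sym (orient-aab a p)) q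
  degenerate {a} {b} {p} (inj₂ (q , _)) = <-irrefl (orient-aab a p) q

  not-at-vertex : ∀ {a b d} → ¬ InTriangle a b d a
  not-at-vertex {a} {b} (inj₁ (q , _)) = <-irrefl (≈-sym (orient-aba a b)) q
  not-at-vertex {a} {b} (inj₂ (q , _)) = <-irrefl (orient-aba a b) q

  orient-swap-pos : ∀ {a b d} → 0# < orient a b d → orient b a d < 0#
  orient-swap-pos {a} {b} {d} p = <-respˡ (≈-sym (orient-swap a b d)) (neg-neg p)

  orient-swap-neg : ∀ {a b d} → orient a b d < 0# → 0# < orient b a d
  orient-swap-neg {a} {b} {d} p = <-respʳ (≈-sym (orient-swap a b d)) (neg-pos p)

  inTriangle-swap : ∀ {a b d p} → InTriangle a b d p → InTriangle b a d p
  inTriangle-swap (inj₁ (u , v , w)) = inj₂ (orient-swap-pos u , orient-swap-pos w , orient-swap-pos v)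
  inTriangle-swap (inj₂ (u , v , w)) = inj₁ (orient-swap-neg u , orient-swap-neg w , orient-swap-neg v)

  -- If all signs for `xab` were negative, `orient-split` would make `orient a b x` a sum of
  -- negative terms. If they are positive, the sign at side `ab` is given, and the two barycentric
  -- expansions show that the other two, multiplied by the positive `orient a b x`, are sums of
  -- positive products.
  inTriangle-nested : ∀ {a b d x y} → 0# < orient a b x → 0# < orient b d x → 0# < orient d a x →
    InTriangle x a b y → InTriangle a b d y
  inTriangle-nested {a} {b} {d} {x} {y} abx bdx dax (inj₂ (xay , aby , bxy)) =
    ⊥-elim (<-asym abx (<-respˡ (orient-split x a b y) (+-neg (+-neg xay aby) bxy)))
    where
    +-neg : ∀ {u v} → u < 0# → v < 0# → u +ᶠ v < 0#
    +-neg {u} {v} p q = <-trans (<-respʳ (+-identityˡ v) (+-mono-< v p)) q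
  inTriangle-nested {a} {b} {d} {x} {y} abx bdx dax (inj₁ (xay , aby , bxy)) =
    inj₁ (aby
      , *-cancel-pos abx (<-respʳ (≈-sym (barycentric x a b d y))
          (+-pos (*-pos aby bdx) (*-pos bxy (<-respʳ (≈-sym (orient-rotate a b d)) abd))))
      , *-cancel-pos abx (<-respʳ (≈-sym (barycentric′ x a b d y))
          (+-pos (*-pos aby dax) (*-pos xay (<-respʳ (orient-rotate d a b) abd)))))
    where
    abd : 0# < orient a b d
    abd = <-respʳ (orient-split d a b x) (+-pos (+-pos dax abx) bdx)

-- Finite sums, and counting triples with and without order.

χ : Bool → ℕ
χ true  = 1
χ false = 0

_≺_ : ∀ {n} → Fin n → Fin n → Bool
i ≺ j = does (toℕ i ℕ.<? toℕ j)

∑² : ∀ {n} → (Fin n → Fin n → ℕ) → ℕ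
∑² f = sum λ i → sum λ j → f i j

∑³ : ∀ {n} → (Fin n → Fin n → Fin n → ℕ) → ℕ
∑³ f = sum λ i → sum λ j → sum λ k → f i j k

∑< : ∀ {n} → (Fin n → Fin n → Fin n → Bool) → ℕ
∑< t = ∑³ λ i j k → χ (i ≺ j ∧ j ≺ k ∧ t i j k)

sum-allFin : ∀ {n} (f : Fin n → ℕ) → sumᴸ (map f (allFin n)) ≡ sum f
sum-allFin f = trans (cong sumᴸ (List.map-tabulate (λ i → i) f)) (sum-tabulate f)
  where
  sum-tabulate : ∀ {n} (f : Fin n → ℕ) → sumᴸ (tabulate f) ≡ sum f
  sum-tabulate {zero}  f = refl
  sum-tabulate {suc n} f = cong (_+_ (f zero)) (sum-tabulate (f ∘ suc))

sum-allFin-cong : ∀ {n} {f g : Fin n → ℕ} → (∀ i → f i ≡ g i) → sumᴸ (map f (allFin n)) ≡ sum g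
sum-allFin-cong {f = f} e = trans (sum-allFin f) (sum-cong-≗ e)

sum-allFin³ : ∀ {n} {f : Fin n → Fin n → Fin n → ℕ} g → (∀ i j k → f i j k ≡ g i j k) →
  sumᴸ (map (λ i → sumᴸ (map (λ j → sumᴸ (map (λ k → f i j k) (allFin n))) (allFin n))) (allFin n)) ≡ ∑³ g
sum-allFin³ g f≗g = sum-allFin-cong λ i → sum-allFin-cong λ j → sum-allFin-cong (f≗g i j)

-- Names the summand of Defs' triple sums, whose indicator function is local to a where block.
summand : ∀ {n s} {f : Fin n → Fin n → Fin n → ℕ} →
  s ≡ sumᴸ (map (λ i → sumᴸ (map (λ j → sumᴸ (map (λ k → f i j k) (allFin n))) (allFin n))) (allFin n)) →
  Fin n → Fin n → Fin n → ℕ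
summand {f = f} _ = f

triangles-∑ : ∀ {m} (G : Graph m) →
  triangles G ≡ ∑< (λ i j k → adj G i j ∧ adj G j k ∧ adj G i k)
triangles-∑ G = sum-allFin³ _ indicator
  where
  indicator : ∀ i j k → summand {s = triangles G} refl i j k ≡ χ (i ≺ j ∧ j ≺ k ∧ adj G i j ∧ adj G j k ∧ adj G i k)
  indicator i j k with i ≺ j ∧ j ≺ k ∧ adj G i j ∧ adj G j k ∧ adj G i k
  ... | true  = refl
  ... | false = refl

module _ {c ℓ₁ ℓ₂} (F : OrderedField c ℓ₁ ℓ₂) where
  open Geometry F

  countTriples-∑ : ∀ n t → countTriples n t ≡ ∑< t
  countTriples-∑ n t = sum-allFin³ _ indicator
    where
    indicator : ∀ i j k → summand {s = countTriples n t} refl i j k ≡ χ (i ≺ j ∧ j ≺ k ∧ t i j k)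
    indicator i j k with i ≺ j ∧ j ≺ k ∧ t i j k
    ... | true  = refl
    ... | false = refl

module _ {n : ℕ} where

  ∑²-cong : {f g : Fin n → Fin n → ℕ} → (∀ i j → f i j ≡ g i j) → ∑² f ≡ ∑² g
  ∑²-cong e = sum-cong-≗ λ i → sum-cong-≗ (e i)

  ∑³-cong : {f g : Fin n → Fin n → Fin n → ℕ} → (∀ i j k → f i j k ≡ g i j k) → ∑³ f ≡ ∑³ g
  ∑³-cong e = sum-cong-≗ λ i → ∑²-cong (e i)

  ∑²-+ : (f g : Fin n → Fin n → ℕ) → ∑² (λ i j → f i j + g i j) ≡ ∑² f + ∑² g
  ∑²-+ f g = trans (sum-cong-≗ λ i → ∑-distrib-+ (f i) (g i)) (∑-distrib-+ (sum ∘ f) (sum ∘ g))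

  ∑³-+ : (f g : Fin n → Fin n → Fin n → ℕ) → ∑³ (λ i j k → f i j k + g i j k) ≡ ∑³ f + ∑³ g
  ∑³-+ f g = trans (sum-cong-≗ λ i → ∑²-+ (f i) (g i)) (∑-distrib-+ (∑² ∘ f) (∑² ∘ g))

  ∑³-swap₁₂ : (f : Fin n → Fin n → Fin n → ℕ) → ∑³ (λ i j k → f j i k) ≡ ∑³ f
  ∑³-swap₁₂ f = ∑-comm (λ i j → sum (f j i))

  ∑³-swap₂₃ : (f : Fin n → Fin n → Fin n → ℕ) → ∑³ (λ i j k → f i k j) ≡ ∑³ f
  ∑³-swap₂₃ f = sum-cong-≗ λ i → ∑-comm (λ j k → f i k j)

sum-mono : ∀ {n} {f g : Fin n → ℕ} → (∀ i → f i ≤ g i) → sum f ≤ sum g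
sum-mono {zero}  le = z≤n
sum-mono {suc n} le = ℕ.+-mono-≤ (le zero) (sum-mono (le ∘ suc))

∑³-mono : ∀ {n} {f g : Fin n → Fin n → Fin n → ℕ} → (∀ i j k → f i j k ≤ g i j k) → ∑³ f ≤ ∑³ g
∑³-mono le = sum-mono λ i → sum-mono λ j → sum-mono (le i j)

term≤sum : ∀ {n} (f : Fin n → ℕ) i → f i ≤ sum f
term≤sum f zero    = ℕ.m≤m+n _ _
term≤sum f (suc i) = ℕ.≤-trans (term≤sum (f ∘ suc) i) (ℕ.m≤n+m _ _)

sum-const : ∀ n c → sum {n} (λ _ → c) ≡ n * c
sum-const zero    c = refl
sum-const (suc n) c = cong (_+_ c) (sum-const n c)

sum-δ : ∀ {n} (f : Fin n → ℕ) x → sum (λ i → χ (does (i ≟ᶠ x)) * f i) ≡ f x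
sum-δ {suc n} f zero = trans (cong (_+_ (1 * f zero)) (trans (sum-const n 0) (ℕ.*-zeroʳ n)))
  (trans (ℕ.+-identityʳ _) (ℕ.*-identityˡ _))
sum-δ {suc n} f (suc x) = trans (sum-cong-≗ {n} step) (sum-δ (f ∘ suc) x)
  where
  step : ∀ i → χ (does (suc i ≟ᶠ suc x)) * f (suc i) ≡ χ (does (i ≟ᶠ x)) * f (suc i)
  step i with i ≟ᶠ x
  ... | yes _ = refl
  ... | no  _ = refl

does-true : ∀ {p} {P : Set p} (P? : Dec P) → does P? ≡ true → P
does-true (yes p) _ = p

∑<-cong : ∀ {n} {t t′ : Fin n → Fin n → Fin n → Bool} →
  (∀ {i j k} → toℕ i ℕ.< toℕ j → toℕ j ℕ.< toℕ k → t i j k ≡ t′ i j k) → ∑< t ≡ ∑< t′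
∑<-cong h = ∑³-cong λ i j k → cong χ (∧-cong (i ≺ j) λ p → ∧-cong (j ≺ k) λ q →
  h (does-true (toℕ i ℕ.<? toℕ j) p) (does-true (toℕ j ℕ.<? toℕ k) q))
  where
  ∧-cong : ∀ a {b b′} → (a ≡ true → b ≡ b′) → a ∧ b ≡ a ∧ b′
  ∧-cong true  e = e refl
  ∧-cong false e = refl

∑<-zero : ∀ {n} {t : Fin n → Fin n → Fin n → Bool} →
  (∀ {i j k} → toℕ i ℕ.< toℕ j → toℕ j ℕ.< toℕ k → t i j k ≡ false) → ∑< t ≡ 0
∑<-zero {n} h = trans (∑<-cong h) (sum-zero λ i → sum-zero λ j → sum-zero λ k → cong χ
  (trans (cong (i ≺ j ∧_) (Bool.∧-zeroʳ (j ≺ k))) (Bool.∧-zeroʳ (i ≺ j))))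
  where
  sum-zero : {f : Fin n → ℕ} → (∀ i → f i ≡ 0) → sum f ≡ 0
  sum-zero e = trans (sum-cong-≗ e) (trans (sum-const n 0) (ℕ.*-zeroʳ n))

module Symmetric {n} (t : Fin n → Fin n → Fin n → Bool)
  (swap₁₂ : ∀ i j k → t i j k ≡ t j i k) (swap₂₃ : ∀ i j k → t i j k ≡ t i k j)
  (diagonal : ∀ i k → t i i k ≡ false) where

  private
    o : Fin n → Fin n → Fin n → ℕ
    o i j k = χ (i ≺ j ∧ j ≺ k ∧ t i j k)

    -- Of the eight patterns of strict comparisons two contradict transitivity; in each of the other
    -- six exactly one summand survives.
    orders : {i j k : Fin n} → ¬ i ≡ j → ¬ i ≡ k → ¬ j ≡ k →
      χ (i ≺ j ∧ j ≺ k ∧ true) + (χ (i ≺ k ∧ k ≺ j ∧ true) + (χ (j ≺ i ∧ i ≺ k ∧ true) +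
      (χ (j ≺ k ∧ k ≺ i ∧ true) + (χ (k ≺ i ∧ i ≺ j ∧ true) + χ (k ≺ j ∧ j ≺ i ∧ true))))) ≡ 1
    orders {i} {j} {k} i≢j i≢k j≢k
      with ℕ.<-cmp (toℕ i) (toℕ j) | ℕ.<-cmp (toℕ j) (toℕ k) | ℕ.<-cmp (toℕ i) (toℕ k)
    ... | tri≈ _ e _ | _ | _ = ⊥-elim (i≢j (Fin.toℕ-injective e))
    ... | tri< _ _ _ | tri≈ _ e _ | _ = ⊥-elim (j≢k (Fin.toℕ-injective e))
    ... | tri> _ _ _ | tri≈ _ e _ | _ = ⊥-elim (j≢k (Fin.toℕ-injective e))
    ... | tri< _ _ _ | tri< _ _ _ | tri≈ _ e _ = ⊥-elim (i≢k (Fin.toℕ-injective e))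
    ... | tri< _ _ _ | tri> _ _ _ | tri≈ _ e _ = ⊥-elim (i≢k (Fin.toℕ-injective e))
    ... | tri> _ _ _ | tri< _ _ _ | tri≈ _ e _ = ⊥-elim (i≢k (Fin.toℕ-injective e))
    ... | tri> _ _ _ | tri> _ _ _ | tri≈ _ e _ = ⊥-elim (i≢k (Fin.toℕ-injective e))
    ... | tri< a _ _ | tri< b _ _ | tri> ¬c _ _ = ⊥-elim (¬c (ℕ.<-trans a b))
    ... | tri> _ _ a | tri> _ _ b | tri< _ _ ¬c = ⊥-elim (¬c (ℕ.<-trans b a))
    ... | tri< a _ a' | tri< b _ b' | tri< c _ c'
      rewrite dec-true (toℕ i ℕ.<? toℕ j) a | dec-false (toℕ j ℕ.<? toℕ i) a'
        | dec-true (toℕ j ℕ.<? toℕ k) b | dec-false (toℕ k ℕ.<? toℕ j) b'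
        | dec-true (toℕ i ℕ.<? toℕ k) c | dec-false (toℕ k ℕ.<? toℕ i) c' = refl
    ... | tri< a _ a' | tri> b _ b' | tri< c _ c'
      rewrite dec-true (toℕ i ℕ.<? toℕ j) a | dec-false (toℕ j ℕ.<? toℕ i) a'
        | dec-false (toℕ j ℕ.<? toℕ k) b | dec-true (toℕ k ℕ.<? toℕ j) b'
        | dec-true (toℕ i ℕ.<? toℕ k) c | dec-false (toℕ k ℕ.<? toℕ i) c' = refl
    ... | tri< a _ a' | tri> b _ b' | tri> c _ c'
      rewrite dec-true (toℕ i ℕ.<? toℕ j) a | dec-false (toℕ j ℕ.<? toℕ i) a'
        | dec-false (toℕ j ℕ.<? toℕ k) b | dec-true (toℕ k ℕ.<? toℕ j) b'
        | dec-false (toℕ i ℕ.<? toℕ k) c | dec-true (toℕ k ℕ.<? toℕ i) c' = refl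
    ... | tri> a _ a' | tri< b _ b' | tri< c _ c'
      rewrite dec-false (toℕ i ℕ.<? toℕ j) a | dec-true (toℕ j ℕ.<? toℕ i) a'
        | dec-true (toℕ j ℕ.<? toℕ k) b | dec-false (toℕ k ℕ.<? toℕ j) b'
        | dec-true (toℕ i ℕ.<? toℕ k) c | dec-false (toℕ k ℕ.<? toℕ i) c' = refl
    ... | tri> a _ a' | tri< b _ b' | tri> c _ c'
      rewrite dec-false (toℕ i ℕ.<? toℕ j) a | dec-true (toℕ j ℕ.<? toℕ i) a'
        | dec-true (toℕ j ℕ.<? toℕ k) b | dec-false (toℕ k ℕ.<? toℕ j) b'
        | dec-false (toℕ i ℕ.<? toℕ k) c | dec-true (toℕ k ℕ.<? toℕ i) c' = refl
    ... | tri> a _ a' | tri> b _ b' | tri> c _ c'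
      rewrite dec-false (toℕ i ℕ.<? toℕ j) a | dec-true (toℕ j ℕ.<? toℕ i) a'
        | dec-false (toℕ j ℕ.<? toℕ k) b | dec-true (toℕ k ℕ.<? toℕ j) b'
        | dec-false (toℕ i ℕ.<? toℕ k) c | dec-true (toℕ k ℕ.<? toℕ i) c' = refl

    distinct : {i j k : Fin n} → t i j k ≡ true → ¬ i ≡ j × ¬ i ≡ k × ¬ j ≡ k
    distinct {i} {j} {k} tt =
      (λ { refl → absurd (diagonal i k) tt }) ,
      (λ { refl → absurd (trans (≡.sym (swap₂₃ i i j)) (diagonal i j)) tt }) ,
      (λ { refl → absurd (trans (≡.sym (swap₁₂ j i j)) (trans (≡.sym (swap₂₃ j j i)) (diagonal j i))) tt })
      where
      absurd : ∀ {b} → b ≡ false → b ≡ true → ⊥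
      absurd refl ()

    split : ∀ i j k → χ (t i j k) ≡
      o i j k + (o i k j + (o j i k + (o j k i + (o k i j + o k j i))))
    split i j k = trans (split′ (t i j k) refl)
      (cong (_+_ (o i j k)) (cong₂ _+_ (reorder (i ≺ k) (k ≺ j) ikj) (cong₂ _+_ (reorder (j ≺ i) (i ≺ k) jik)
        (cong₂ _+_ (reorder (j ≺ k) (k ≺ i) jki) (cong₂ _+_ (reorder (k ≺ i) (i ≺ j) kij) (reorder (k ≺ j) (j ≺ i) kji))))))
      where
      ikj : t i j k ≡ t i k j
      ikj = swap₂₃ i j k
      jik : t i j k ≡ t j i k
      jik = swap₁₂ i j k
      jki : t i j k ≡ t j k i
      jki = trans jik (swap₂₃ j i k)
      kij : t i j k ≡ t k i j
      kij = trans ikj (swap₁₂ i k j)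
      kji : t i j k ≡ t k j i
      kji = trans kij (swap₂₃ k i j)
      reorder : ∀ p q {b b'} → b ≡ b' → χ (p ∧ q ∧ b) ≡ χ (p ∧ q ∧ b')
      reorder p q refl = refl
      zero-at : ∀ p q → χ (p ∧ q ∧ false) ≡ 0
      zero-at p q = cong χ (trans (cong (p ∧_) (Bool.∧-zeroʳ q)) (Bool.∧-zeroʳ p))
      split′ : ∀ b → t i j k ≡ b → χ b ≡
        χ (i ≺ j ∧ j ≺ k ∧ b) + (χ (i ≺ k ∧ k ≺ j ∧ b) + (χ (j ≺ i ∧ i ≺ k ∧ b) +
        (χ (j ≺ k ∧ k ≺ i ∧ b) + (χ (k ≺ i ∧ i ≺ j ∧ b) + χ (k ≺ j ∧ j ≺ i ∧ b)))))
      split′ true  e = let (i≢j , i≢k , j≢k) = distinct e in ≡.sym (orders i≢j i≢k j≢k)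
      split′ false e = ≡.sym (cong₂ _+_ (zero-at (i ≺ j) _) (cong₂ _+_ (zero-at (i ≺ k) _)
        (cong₂ _+_ (zero-at (j ≺ i) _) (cong₂ _+_ (zero-at (j ≺ k) _)
        (cong₂ _+_ (zero-at (k ≺ i) _) (zero-at (k ≺ j) _))))))

  -- Each set of three indices has six orderings, all with the same value of `t`, and triples with a
  -- repeated index contribute nothing.
  ∑³-symmetric : ∑³ (λ i j k → χ (t i j k)) ≡ 6 * ∑< t
  ∑³-symmetric = trans (∑³-cong split)
    (trans (∑³-+ o _) (cong (_+_ (∑< t))
    (trans (∑³-+ (λ i j k → o i k j) _) (cong₂ _+_ (∑³-swap₂₃ o)
    (trans (∑³-+ (λ i j k → o j i k) _) (cong₂ _+_ (∑³-swap₁₂ o)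
    (trans (∑³-+ (λ i j k → o j k i) _) (cong₂ _+_ (trans (∑³-swap₁₂ (λ i j k → o i k j)) (∑³-swap₂₃ o))
    (trans (∑³-+ (λ i j k → o k i j) _) (cong₂ _+_ (trans (∑³-swap₂₃ (λ i j k → o j i k)) (∑³-swap₁₂ o))
    (trans (trans (∑³-swap₂₃ (λ i j k → o j k i)) (trans (∑³-swap₁₂ (λ i j k → o i k j)) (∑³-swap₂₃ o)))
      (≡.sym (ℕ.+-identityʳ (∑< t))))))))))))))

open Symmetric public using (∑³-symmetric)

-- The kite-free graph on the arcs of a digraph.

lookup-injective : ∀ {a} {A : Set a} {xs : List A} → Unique xs →
  ∀ i j → lookup xs i ≡ lookup xs j → i ≡ j
lookup-injective (_ ∷ _)  zero    zero    _ = refl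
lookup-injective {xs = _ ∷ xs} (x≢ ∷ _) zero (suc j) e = ⊥-elim (All.lookup x≢ (∈-lookup j) e)
lookup-injective {xs = _ ∷ xs} (x≢ ∷ _) (suc i) zero e = ⊥-elim (All.lookup x≢ (∈-lookup i) (≡.sym e))
lookup-injective (_ ∷ u)  (suc i) (suc j) e = cong suc (lookup-injective u i j e)

sum-filter : ∀ {a} {A : Set a} (D : A → Bool) (φ : A → ℕ) xs →
  sumᴸ (map φ (filter (λ x → D x Bool.≟ true) xs)) ≡ sumᴸ (map (λ x → χ (D x) * φ x) xs)
sum-filter D φ [] = refl
sum-filter D φ (x ∷ xs) with D x
... | true  = cong₂ _+_ (≡.sym (ℕ.*-identityˡ (φ x))) (sum-filter D φ xs)
... | false = sum-filter D φ xs

sum-cartesianProduct : ∀ {a b} {A : Set a} {B : Set b} (φ : A → B → ℕ) xs ys →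
  sumᴸ (map (uncurry φ) (cartesianProduct xs ys)) ≡ sumᴸ (map (λ x → sumᴸ (map (φ x) ys)) xs)
sum-cartesianProduct φ [] ys = refl
sum-cartesianProduct φ (x ∷ xs) ys =
  trans (cong sumᴸ (List.map-++ (uncurry φ) (map (x ,_) ys) (cartesianProduct xs ys)))
    (trans (sum-++ (map (uncurry φ) (map (x ,_) ys)) _)
      (cong₂ _+_ (cong sumᴸ (≡.sym (List.map-∘ ys))) (sum-cartesianProduct φ xs ys)))

sum-lookup : ∀ {a} {A : Set a} (φ : A → ℕ) xs → sum (λ i → φ (lookup xs i)) ≡ sumᴸ (map φ xs)
sum-lookup φ []       = refl
sum-lookup φ (x ∷ xs) = cong (_+_ (φ x)) (sum-lookup φ xs)

∧-true : ∀ {a b} → a ∧ b ≡ true → a ≡ true × b ≡ true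
∧-true {true} {true} _ = refl , refl

∨-true : ∀ {a b} → a ∨ b ≡ true → a ≡ true ⊎ b ≡ true
∨-true {true} _ = inj₁ refl
∨-true {false} e = inj₂ e

module LineGraph {n} (D : Fin n → Fin n → Bool) (loopless : ∀ a → D a a ≡ false) where

  -- Vertices of a `Graph` are elements of a `Fin`, so the arcs are listed and a vertex is a
  -- position in the list.
  arcs : List (Fin n × Fin n)
  arcs = filter (λ (a , b) → D a b Bool.≟ true) (cartesianProduct (allFin n) (allFin n))

  arcs-unique : Unique arcs
  arcs-unique = Unique.filter⁺ _ (Unique.cartesianProduct⁺ (Unique.allFin⁺ n) (Unique.allFin⁺ n))

  sum-arcs : (φ : Fin n → Fin n → ℕ) →
    sum (λ e → uncurry φ (lookup arcs e)) ≡ ∑² (λ a b → χ (D a b) * φ a b)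
  sum-arcs φ = trans (sum-lookup (uncurry φ) arcs)
    (trans (sum-filter (uncurry D) (uncurry φ) (cartesianProduct (allFin n) (allFin n)))
    (trans (sum-cartesianProduct (λ a b → χ (D a b) * φ a b) (allFin n) (allFin n))
    (sum-allFin-cong λ a → sum-allFin (λ b → χ (D a b) * φ a b))))

  length-arcs : length arcs ≡ ∑² (λ a b → χ (D a b))
  length-arcs = trans (≡.sym (trans (sum-const (length arcs) 1) (ℕ.*-identityʳ _)))
    (trans (sum-arcs (λ _ _ → 1)) (∑²-cong λ a b → ℕ.*-identityʳ (χ (D a b))))

  order : ℕ
  order = length arcs

  src tgt : Fin order → Fin n
  src e = proj₁ (lookup arcs e)
  tgt e = proj₂ (lookup arcs e)

  arc : ∀ e → D (src e) (tgt e) ≡ true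
  arc e = All.lookup (All.all-filter (λ (a , b) → D a b Bool.≟ true) (cartesianProduct (allFin n) (allFin n))) (∈-lookup e)

  arc-injective : ∀ {e f} → src e ≡ src f → tgt e ≡ tgt f → e ≡ f
  arc-injective p q = lookup-injective arcs-unique _ _ (cong₂ _,_ p q)

  tgt≢src : ∀ e → ¬ tgt e ≡ src e
  tgt≢src e p with trans (≡.sym (arc e)) (trans (cong (D (src e)) p) (loopless (src e)))
  ... | ()

  -- e then f are two consecutive sides of a directed triangle.
  follows : Fin order → Fin order → Bool
  follows e f = does (tgt e ≟ᶠ src f) ∧ D (tgt f) (src e)

  follows⇒ : ∀ {e f} → follows e f ≡ true → tgt e ≡ src f × D (tgt f) (src e) ≡ true
  follows⇒ {e} {f} p = let (q , r) = ∧-true p in does-true (tgt e ≟ᶠ src f) q , r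

  graph : Graph order
  graph = record
    { adj = λ e f → follows e f ∨ follows f e
    ; sym = λ e f → Bool.∨-comm (follows e f) (follows f e)
    ; irr = λ e → trans (Bool.∨-idem (follows e e)) (cong (_∧ D (tgt e) (src e)) (dec-false (tgt e ≟ᶠ src e) (tgt≢src e)))
    }

  private
    -- Each of the two adjacencies of `c` has two possible directions. Three of the four
    -- combinations force a loop; the remaining one makes `c` the arc that closes the path `a`, `b`.
    third : ∀ {a b c} → tgt a ≡ src b → adj graph a c ≡ true → adj graph b c ≡ true →
      src c ≡ tgt b × tgt c ≡ src a
    third {a} {b} {c} ab ac bc with ∨-true {follows a c} ac | ∨-true {follows b c} bc
    ... | inj₁ p | inj₁ q = ⊥-elim (tgt≢src b (trans (proj₁ (follows⇒ {b} {c} q)) (trans (≡.sym (proj₁ (follows⇒ {a} {c} p))) ab)))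
    ... | inj₁ p | inj₂ q = ⊥-elim (tgt≢src c (trans (proj₁ (follows⇒ {c} {b} q)) (trans (≡.sym ab) (proj₁ (follows⇒ {a} {c} p)))))
    ... | inj₂ p | inj₁ q = ≡.sym (proj₁ (follows⇒ {b} {c} q)) , proj₁ (follows⇒ {c} {a} p)
    ... | inj₂ p | inj₂ q = ⊥-elim (tgt≢src a (trans ab (trans (≡.sym (proj₁ (follows⇒ {c} {b} q))) (proj₁ (follows⇒ {c} {a} p)))))

    unique-third : ∀ {a b c d} → tgt a ≡ src b →
      adj graph a c ≡ true → adj graph b c ≡ true → adj graph a d ≡ true → adj graph b d ≡ true → c ≡ d
    unique-third {a} {b} ab ac bc ad bd =
      let (p , q) = third {a} {b} ab ac bc
          (r , s) = third {a} {b} ab ad bd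
      in arc-injective (trans p (≡.sym r)) (trans q (≡.sym s))

  -- The vertices `c` and `d` both complete the edge `ab` to a triangle. Whichever of `a`, `b` comes
  -- first, both are the arc closing the path, hence equal.
  kite-free : ¬ ContainsKite graph
  kite-free (a , b , c , d , (_ , _ , _ , _ , _ , c≢d) , (ab , ac , bc , ad , bd))
    with ∨-true {follows a b} ab
  ... | inj₁ p = c≢d (unique-third {a} {b} (proj₁ (follows⇒ {a} {b} p)) ac bc ad bd)
  ... | inj₂ p = c≢d (unique-third {b} {a} (proj₁ (follows⇒ {b} {a} p)) bc ac bd ad)

  -- Taking endpoints instead of arc positions lets `sum-arcs` turn each sum over arcs into a sum
  -- over pairs of points.
  cyclic : (a b c d p q : Fin n) → Bool
  cyclic a b c d p q = does (b ≟ᶠ c) ∧ does (d ≟ᶠ p) ∧ does (q ≟ᶠ a)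

  cyc : (e f g : Fin order) → Bool
  cyc e f g = cyclic (src e) (tgt e) (src f) (tgt f) (src g) (tgt g)

  cyc⇒ : ∀ {e f g} → cyc e f g ≡ true → tgt e ≡ src f × tgt f ≡ src g × tgt g ≡ src e
  cyc⇒ {e} {f} {g} p =
    let (q , r) = ∧-true {does (tgt e ≟ᶠ src f)} p
        (r , s) = ∧-true {does (tgt f ≟ᶠ src g)} r
    in does-true (_ ≟ᶠ _) q , does-true (_ ≟ᶠ _) r , does-true (_ ≟ᶠ _) s

  tri : (e f g : Fin order) → Bool
  tri e f g = adj graph e f ∧ adj graph f g ∧ adj graph e g

  private
    follows-by : ∀ {e f g} → tgt e ≡ src f → tgt f ≡ src g → tgt g ≡ src e → follows e f ≡ true
    follows-by {e} {f} {g} p q r rewrite dec-true (tgt e ≟ᶠ src f) p =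
      trans (cong₂ D q (≡.sym r)) (arc g)

    adjˡ : ∀ {e f} → follows e f ≡ true → adj graph e f ≡ true
    adjˡ {e} {f} p rewrite p = refl

    adjʳ : ∀ {e f} → follows f e ≡ true → adj graph e f ≡ true
    adjʳ {e} {f} p rewrite p = Bool.∨-zeroʳ _

    tri-intro : ∀ {e f g} → adj graph e f ≡ true → adj graph f g ≡ true → adj graph e g ≡ true → tri e f g ≡ true
    tri-intro p q r rewrite p | q = r

    cyc⇒tri : ∀ {e f g} → cyc e f g ≡ true → tri e f g ≡ true
    cyc⇒tri {e} {f} {g} t = let (p , q , r) = cyc⇒ {e} {f} {g} t in
      tri-intro {e} {f} {g} (adjˡ {e} {f} (follows-by {e} {f} {g} p q r)) (adjˡ {f} {g} (follows-by {f} {g} {e} q r p))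
        (adjʳ {e} {g} (follows-by {g} {e} {f} r p q))

    cyc⇒tri′ : ∀ {e f g} → cyc e g f ≡ true → tri e f g ≡ true
    cyc⇒tri′ {e} {f} {g} t = let (p , q , r) = cyc⇒ {e} {g} {f} t in
      tri-intro {e} {f} {g} (adjʳ {e} {f} (follows-by {f} {e} {g} r p q)) (adjʳ {f} {g} (follows-by {g} {f} {e} q r p))
        (adjˡ {e} {g} (follows-by {e} {g} {f} p q r))

    -- Both `f` and `g` would start where `e` ends, while `f` ends where `g` starts, so `f` would be
    -- a loop.
    cyc-disjoint : ∀ {e f g} → cyc e f g ≡ true → cyc e g f ≡ true → ⊥
    cyc-disjoint {e} {f} {g} t t′ =
      let (p , q , _) = cyc⇒ {e} {f} {g} t
          (p′ , _ , _) = cyc⇒ {e} {g} {f} t′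
      in tgt≢src f (trans q (trans (≡.sym p′) p))

    χ-+-≤ : ∀ {a b c} → (a ≡ true → c ≡ true) → (b ≡ true → c ≡ true) → (a ≡ true → b ≡ true → ⊥) →
      χ a + χ b ≤ χ c
    χ-+-≤ {true}  {true}  _ _ h = ⊥-elim (h refl refl)
    χ-+-≤ {true}  {false} h _ _ rewrite h refl = ℕ.≤-refl
    χ-+-≤ {false} {true}  _ h _ rewrite h refl = ℕ.≤-refl
    χ-+-≤ {false} {false} _ _ _ = z≤n

  -- The number of closed walks of length three: every directed 3-cycle is counted once for each
  -- starting point.
  cycles : ℕ
  cycles = ∑³ (λ a b d → χ (D a b) * (χ (D b d) * χ (D d a)))

  -- A closed walk `a`, `b`, `d` yields the triple of arcs `ab`, `bd`, `da`. The sums over arcs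
  -- become sums over all endpoints, of which only the matching terms are kept.
  cycles≤ : cycles ≤ ∑³ (λ e f g → χ (cyc e f g))
  cycles≤ = begin
    sum (λ a → sum λ b → sum λ d → χ (D a b) * (χ (D b d) * χ (D d a)))
      ≡⟨ ∑²-cong (λ a b → ≡.sym (*-distribˡ-sum (χ (D a b)) (λ d → χ (D b d) * χ (D d a)))) ⟩
    ∑² (λ a b → χ (D a b) * sum (λ d → χ (D b d) * χ (D d a)))
      ≤⟨ (sum-mono λ a → sum-mono λ b → ℕ.*-monoʳ-≤ (χ (D a b)) (begin
           sum (λ d → χ (D b d) * χ (D d a))
             ≤⟨ sum-mono (λ d → ℕ.*-monoʳ-≤ (χ (D b d)) (inner a b d)) ⟩
           sum (λ d → χ (D b d) * last-side a b b d)
             -- Among all possible sources `c` of the second arc, keep only `b`, where the first arc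
             -- ends.
             ≤⟨ term≤sum (λ c → sum (λ d → χ (D c d) * last-side a b c d)) b ⟩
           ∑² (λ c d → χ (D c d) * last-side a b c d) ∎)) ⟩
    ∑² (λ a b → χ (D a b) * ∑² (λ c d → χ (D c d) * last-side a b c d))
      ≡⟨ sum-arcs (λ a b → ∑² (λ c d → χ (D c d) * last-side a b c d)) ⟨
    sum (λ e → ∑² (λ c d → χ (D c d) * last-side (src e) (tgt e) c d))
      ≡⟨ sum-cong-≗ (λ e → ≡.sym (sum-arcs (last-side (src e) (tgt e)))) ⟩
    ∑³ (λ e f g → χ (cyc e f g)) ∎
    where
    open ℕ.≤-Reasoning
    last-side : (a b c d : Fin n) → ℕ
    last-side a b c d = sum λ g → χ (cyclic a b c d (src g) (tgt g))
    inner : ∀ a b d → χ (D d a) ≤ last-side a b b d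
    inner a b d = begin
      χ (D d a)                              ≡⟨ ℕ.*-identityʳ _ ⟨
      χ (D d a) * 1                          ≡⟨ cong (χ (D d a) *_) (cong χ self) ⟨
      χ (D d a) * χ (cyclic a b b d d a)     ≤⟨ term≤sum (λ q → χ (D d q) * χ (cyclic a b b d d q)) a ⟩
      sum (λ q → χ (D d q) * χ (cyclic a b b d d q))
        ≤⟨ term≤sum (λ p → sum (λ q → χ (D p q) * χ (cyclic a b b d p q))) d ⟩
      ∑² (λ p q → χ (D p q) * χ (cyclic a b b d p q)) ≡⟨ sum-arcs (λ p q → χ (cyclic a b b d p q)) ⟨
      last-side a b b d ∎
      where
      self : cyclic a b b d d a ≡ true
      self rewrite dec-true (b ≟ᶠ b) refl | dec-true (d ≟ᶠ d) refl | dec-true (a ≟ᶠ a) refl = refl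

  tri-swap₁₂ : ∀ e f g → tri e f g ≡ tri f e g
  tri-swap₁₂ e f g = cong₂ _∧_ (sym graph e f) (Bool.∧-comm (adj graph f g) (adj graph e g))

  tri-swap₂₃ : ∀ e f g → tri e f g ≡ tri e g f
  tri-swap₂₃ e f g = trans (rotate (adj graph e f) (adj graph f g) (adj graph e g))
    (cong (λ b → adj graph e g ∧ b ∧ adj graph e f) (sym graph f g))
    where
    rotate : ∀ a b c → a ∧ b ∧ c ≡ c ∧ b ∧ a
    rotate a b c = trans (cong (a ∧_) (Bool.∧-comm b c)) (trans (Bool.∧-comm a (c ∧ b)) (Bool.∧-assoc c b a))

  -- An ordered triple of arcs can be cyclic as `e f g` or as `e g f`, never both, and in either
  -- case it is a triangle of the graph. Summing both possibilities gives the 2; the six orderings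
  -- of a triangle give the 6.
  2*cycles≤6*triangles : 2 * cycles ≤ 6 * triangles graph
  2*cycles≤6*triangles = begin
    cycles + (cycles + 0)     ≡⟨ cong (_+_ cycles) (ℕ.+-identityʳ cycles) ⟩
    cycles + cycles           ≤⟨ ℕ.+-mono-≤ cycles≤ cycles≤ ⟩
    ∑³ χcyc + ∑³ χcyc         ≡⟨ cong (_+_ (∑³ χcyc)) (∑³-swap₂₃ χcyc) ⟨
    ∑³ χcyc + ∑³ (λ e f g → χcyc e g f) ≡⟨ ∑³-+ χcyc (λ e f g → χcyc e g f) ⟨
    ∑³ (λ e f g → χcyc e f g + χcyc e g f)
      ≤⟨ ∑³-mono (λ e f g → χ-+-≤ (cyc⇒tri {e} {f} {g}) (cyc⇒tri′ {e} {f} {g}) (cyc-disjoint {e} {f} {g})) ⟩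
    ∑³ (λ e f g → χ (tri e f g))
      ≡⟨ ∑³-symmetric tri tri-swap₁₂ tri-swap₂₃ (λ e g → cong (_∧ (adj graph e g ∧ adj graph e g)) (irr graph e)) ⟩
    6 * ∑< tri                ≡⟨ cong (6 *_) (triangles-∑ graph) ⟨
    6 * triangles graph       ∎
    where
    open ℕ.≤-Reasoning
    χcyc : (e f g : Fin order) → ℕ
    χcyc e f g = χ (cyc e f g)

  cycles-IsH : ∀ {h} → IsH (∑² (λ a b → χ (D a b))) h → 2 * cycles ≤ 6 * h
  cycles-IsH {h} isH with subst (λ m → IsH m h) (≡.sym length-arcs) isH
  ... | _ , max = ℕ.≤-trans 2*cycles≤6*triangles (ℕ.*-monoʳ-≤ 6 (max graph kite-free))

-- Consequences of a balance of counts, and triples through a fixed point.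

module _ {a b t v : ℕ} (balance : a + t ≡ v + b) where

  -- In the integers `balance` reads a - b = v - t.
  difference-≤ : ∣ a - b ∣ ≤ v + t
  difference-≤ with ℕ.≤-total a b
  ... | inj₁ a≤b rewrite ℕ.m≤n⇒∣m-n∣≡n∸m a≤b = ℕ.m≤n+o⇒m∸n≤o b a (begin
    b           ≤⟨ ℕ.m≤n+m b v ⟩
    v + b       ≡⟨ balance ⟨
    a + t       ≤⟨ ℕ.+-monoʳ-≤ a (ℕ.m≤n+m t v) ⟩
    a + (v + t) ∎)
    where open ℕ.≤-Reasoning
  ... | inj₂ b≤a rewrite ℕ.m≤n⇒∣n-m∣≡n∸m b≤a = ℕ.m≤n+o⇒m∸n≤o a b (begin
    a           ≤⟨ ℕ.m≤m+n a t ⟩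
    a + t       ≡⟨ balance ⟩
    v + b       ≡⟨ ℕ.+-comm v b ⟩
    b + v       ≤⟨ ℕ.+-monoʳ-≤ b (ℕ.m≤m+n v t) ⟩
    b + (v + t) ∎)
    where open ℕ.≤-Reasoning

  ≤-difference : t ≤ ∣ a - b ∣ + v
  ≤-difference = ℕ.+-cancelˡ-≤ a _ _ (begin
    a + t                 ≡⟨ balance ⟩
    v + b                 ≤⟨ ℕ.+-monoʳ-≤ v (ℕ.m≤n+∣n-m∣ b a) ⟩
    v + (a + ∣ a - b ∣)    ≡⟨ ℕ.+-comm v _ ⟩
    a + ∣ a - b ∣ + v      ≡⟨ ℕ.+-assoc a _ v ⟩
    a + (∣ a - b ∣ + v)    ∎)
    where open ℕ.≤-Reasoning

≤-difference′ : ∀ {a b t v} → a + t ≡ v + b → v ≤ ∣ a - b ∣ + t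
≤-difference′ {a} {b} {t} {v} balance = subst (λ d → v ≤ d + t) (ℕ.∣-∣-comm b a)
  (≤-difference {b} {a} {v} {t} (trans (ℕ.+-comm b v) (trans (≡.sym balance) (ℕ.+-comm a t))))

bool-≡ : ∀ {a b} → (a ≡ true → b ≡ true) → (b ≡ true → a ≡ true) → a ≡ b
bool-≡ {true}  f g = ≡.sym (f refl)
bool-≡ {false} {true}  f g = g refl
bool-≡ {false} {false} f g = refl

χ-∨ : ∀ a b → (a ≡ true → b ≡ true → ⊥) → χ (a ∨ b) ≡ χ a + χ b
χ-∨ true  true  disjoint = ⊥-elim (disjoint refl refl)
χ-∨ true  false _        = refl
χ-∨ false b     _        = refl

∨-swap : ∀ a b d → a ∨ b ∨ d ≡ b ∨ a ∨ d
∨-swap a b d = trans (≡.sym (Bool.∨-assoc a b d)) (trans (cong (_∨ d) (Bool.∨-comm a b)) (Bool.∨-assoc b a d))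

module Incidence {n} (x : Fin n) where

  has-x : Fin n → Fin n → Fin n → Bool
  has-x i j k = does (i ≟ᶠ x) ∨ does (j ≟ᶠ x) ∨ does (k ≟ᶠ x)

  has-x-none : ∀ {i j k} → ¬ i ≡ x → ¬ j ≡ x → ¬ k ≡ x → has-x i j k ≡ false
  has-x-none {i} {j} {k} p q r =
    cong₂ _∨_ (dec-false (i ≟ᶠ x) p) (cong₂ _∨_ (dec-false (j ≟ᶠ x) q) (dec-false (k ≟ᶠ x) r))

module Incident {n} (x : Fin n) (U : Fin n → Fin n → Bool) (U-sym : ∀ a b → U a b ≡ U b a)
  (U-diagonal : ∀ a → U a a ≡ false) (U-x : ∀ b → U x b ≡ false) where
  open Incidence x

  -- A symmetric replacement for `has-x` joined with emptiness. A degenerate triangle has no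
  -- interior and so counts as empty; here such triples give `false`, as `∑³-symmetric` requires.
  v : Fin n → Fin n → Fin n → Bool
  v i j k = (does (i ≟ᶠ x) ∧ U j k) ∨ (does (j ≟ᶠ x) ∧ U i k) ∨ (does (k ≟ᶠ x) ∧ U i j)

  v-swap₁₂ : ∀ i j k → v i j k ≡ v j i k
  v-swap₁₂ i j k = trans (∨-swap (does (i ≟ᶠ x) ∧ U j k) (does (j ≟ᶠ x) ∧ U i k) _)
    (cong (λ u → (does (j ≟ᶠ x) ∧ U i k) ∨ (does (i ≟ᶠ x) ∧ U j k) ∨ (does (k ≟ᶠ x) ∧ u)) (U-sym i j))

  v-swap₂₃ : ∀ i j k → v i j k ≡ v i k j
  v-swap₂₃ i j k = cong₂ _∨_ (cong (does (i ≟ᶠ x) ∧_) (U-sym j k)) (Bool.∨-comm (does (j ≟ᶠ x) ∧ U i k) _)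

  δU : ∀ i k → does (i ≟ᶠ x) ∧ U i k ≡ false
  δU i k with i ≟ᶠ x
  ... | yes refl = U-x k
  ... | no _ = refl

  v-diagonal : ∀ i k → v i i k ≡ false
  v-diagonal i k = cong₂ _∨_ (δU i k) (cong₂ _∨_ (δU i k)
    (trans (cong (does (k ≟ᶠ x) ∧_) (U-diagonal i)) (Bool.∧-zeroʳ _)))

  χ-v : ∀ i j k → χ (v i j k) ≡ χ (does (i ≟ᶠ x)) * χ (U j k) +
    (χ (does (j ≟ᶠ x)) * χ (U i k) + χ (does (k ≟ᶠ x)) * χ (U i j))
  χ-v i j k with i ≟ᶠ x | j ≟ᶠ x | k ≟ᶠ x
  ... | yes refl | yes refl | yes refl rewrite U-x x = refl
  ... | yes refl | yes refl | no _ rewrite U-x k = refl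
  ... | yes refl | no _ | yes refl rewrite U-sym j x | U-x j = refl
  ... | yes refl | no _ | no _ = trans (cong χ (Bool.∨-identityʳ (U j k)))
    (≡.sym (trans (ℕ.+-identityʳ _) (ℕ.*-identityˡ (χ (U j k)))))
  ... | no _ | yes refl | yes refl rewrite U-sym i x | U-x i = refl
  ... | no _ | yes refl | no _ = trans (cong χ (Bool.∨-identityʳ (U i k)))
    (≡.sym (trans (ℕ.+-identityʳ _) (ℕ.*-identityˡ (χ (U i k)))))
  ... | no _ | no _ | yes refl = ≡.sym (ℕ.*-identityˡ _)
  ... | no _ | no _ | no _ = refl

  v-distinct : (E : Fin n → Fin n → Fin n → Bool) →
    (∀ i j k → E i j k ≡ E j i k) → (∀ i j k → E i j k ≡ E j k i) →
    (∀ {j k} → ¬ j ≡ x → ¬ k ≡ x → ¬ j ≡ k → E x j k ≡ U j k) →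
    ∀ {i j k} → ¬ i ≡ j → ¬ i ≡ k → ¬ j ≡ k → has-x i j k ∧ E i j k ≡ v i j k
  v-distinct E swap₁₂ rotate E-U {i} {j} {k} i≢j i≢k j≢k with i ≟ᶠ x | j ≟ᶠ x | k ≟ᶠ x
  ... | yes refl | yes refl | _ = ⊥-elim (i≢j refl)
  ... | yes refl | no _ | yes refl = ⊥-elim (i≢k refl)
  ... | no _ | yes refl | yes refl = ⊥-elim (j≢k refl)
  ... | yes refl | no j≢x | no k≢x = trans (E-U j≢x k≢x j≢k) (≡.sym (Bool.∨-identityʳ (U j k)))
  ... | no i≢x | yes refl | no k≢x = trans (swap₁₂ i j k) (trans (E-U i≢x k≢x i≢k) (≡.sym (Bool.∨-identityʳ (U i k))))
  ... | no i≢x | no j≢x | yes refl = trans (≡.sym (rotate k i j)) (E-U i≢x j≢x i≢j)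
  ... | no _ | no _ | no _ = refl

  ∑³-v : ∑³ (λ i j k → χ (v i j k)) ≡ 3 * ∑² (λ a b → χ (U a b))
  ∑³-v = begin
    ∑³ (λ i j k → χ (v i j k)) ≡⟨ ∑³-cong χ-v ⟩
    ∑³ (λ i j k → f i j k + (f j i k + f k i j)) ≡⟨ ∑³-+ f (λ i j k → f j i k + f k i j) ⟩
    ∑³ f + ∑³ (λ i j k → f j i k + f k i j) ≡⟨ cong (_+_ (∑³ f)) (∑³-+ (λ i j k → f j i k) (λ i j k → f k i j)) ⟩
    ∑³ f + (∑³ (λ i j k → f j i k) + ∑³ (λ i j k → f k i j))
      ≡⟨ cong (_+_ (∑³ f)) (cong₂ _+_ (∑³-swap₁₂ f) (trans (∑³-swap₂₃ (λ i j k → f j i k)) (∑³-swap₁₂ f))) ⟩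
    ∑³ f + (∑³ f + ∑³ f) ≡⟨ cong (λ s → ∑³ f + (∑³ f + s)) (ℕ.+-identityʳ (∑³ f)) ⟨
    3 * ∑³ f ≡⟨ cong (3 *_) fold ⟩
    3 * ∑² (λ a b → χ (U a b)) ∎
    where
    open ≡.≡-Reasoning
    f : Fin n → Fin n → Fin n → ℕ
    f i j k = χ (does (i ≟ᶠ x)) * χ (U j k)
    fold : ∑³ f ≡ ∑² (λ a b → χ (U a b))
    fold = trans (sum-cong-≗ λ i → trans
        (sum-cong-≗ λ j → ≡.sym (*-distribˡ-sum (χ (does (i ≟ᶠ x))) (λ k → χ (U j k))))
        (≡.sym (*-distribˡ-sum (χ (does (i ≟ᶠ x))) (λ j → sum λ k → χ (U j k)))))
      (sum-δ (λ _ → ∑² (λ a b → χ (U a b))) x)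

  -- The sum over ordered triples is counted twice: by six orderings, and by the three positions of
  -- `x`. Cancelling 3 leaves this.
  2*∑<v : 2 * ∑< v ≡ ∑² (λ a b → χ (U a b))
  2*∑<v = ℕ.*-cancelˡ-≡ _ _ 3 (trans (≡.sym (ℕ.*-assoc 3 2 (∑< v)))
    (trans (≡.sym (∑³-symmetric v v-swap₁₂ v-swap₂₃ v-diagonal)) ∑³-v))

-- Empty triangles around a deleted point, and the upper bound.

module Configuration {c ℓ₁ ℓ₂} (F : OrderedField c ℓ₁ ℓ₂) where
  open OrderedField F using (0#; _≈_; _<?_) renaming (_<_ to infix 4 _<_; sym to ≈-sym; trans to ≈-trans)
  open Geometry F
  open Field F using (compare; <-irrefl; <-asym; <-respʳ; <-respˡ)
  open Plane F

  module Empty {n} (P : Fin n → Point) (x : Fin n) where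

    E E′ : Fin n → Fin n → Fin n → Bool
    E  i j k = does (emptyIn? P allOf i j k)
    E′ i j k = does (emptyIn? P (without x) i j k)

    E-intro : ∀ {S i j k} → (∀ l → S l ≡ true → ¬ InTriangle (P i) (P j) (P k) (P l)) → does (emptyIn? P S i j k) ≡ true
    E-intro {S} {i} {j} {k} h = dec-true (emptyIn? P S i j k) (All.tabulate λ {l} _ → h l)

    E-elim : ∀ {S i j k} → does (emptyIn? P S i j k) ≡ true → ∀ l → S l ≡ true → ¬ InTriangle (P i) (P j) (P k) (P l)
    E-elim {S} {i} {j} {k} e l = All.lookup (does-true (emptyIn? P S i j k) e) (∈-allFin l)

    E-map : ∀ {S S′ i j k i′ j′ k′} → (∀ l → S′ l ≡ true → S l ≡ true) →
      (∀ {p} → InTriangle (P i′) (P j′) (P k′) p → InTriangle (P i) (P j) (P k) p) →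
      does (emptyIn? P S i j k) ≡ true → does (emptyIn? P S′ i′ j′ k′) ≡ true
    E-map {S} {S′} S⊆ f e = E-intro λ l Sl t → E-elim {S} e l (S⊆ l Sl) (f t)

    module _ {S : Fin n → Bool} where
      E-swap₁₂ : ∀ i j k → does (emptyIn? P S i j k) ≡ does (emptyIn? P S j i k)
      E-swap₁₂ i j k = bool-≡ (E-map {S} {S} (λ _ p → p) inTriangle-swap) (E-map {S} {S} (λ _ p → p) inTriangle-swap)

      E-rotate : ∀ i j k → does (emptyIn? P S i j k) ≡ does (emptyIn? P S j k i)
      E-rotate i j k = bool-≡
        (E-map {S} {S} (λ _ p → p) (inTriangle-rotate ∘ inTriangle-rotate))
        (E-map {S} {S} (λ _ p → p) inTriangle-rotate)

      E-swap₂₃ : ∀ i j k → does (emptyIn? P S i j k) ≡ does (emptyIn? P S i k j)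
      E-swap₂₃ i j k = trans (E-swap₁₂ i j k) (E-rotate j i k)

    E⇒E′ : ∀ i j k → E i j k ≡ true → E′ i j k ≡ true
    E⇒E′ i j k = E-map {allOf} {without x} (λ _ _ → refl) (λ t → t)

    without-≢ : ∀ {l} → ¬ l ≡ x → without x l ≡ true
    without-≢ {l} l≢x = cong not (dec-false (l ≟ᶠ x) l≢x)

    ≢-without : ∀ {l} → without x l ≡ true → ¬ l ≡ x
    ≢-without {l} e l≡x with trans (≡.sym e) (cong not (dec-true (l ≟ᶠ x) l≡x))
    ... | ()

    open Incidence x

    -- The triangles that become empty when x is deleted.
    τ : Fin n → Fin n → Fin n → Bool
    τ i j k = not (has-x i j k) ∧ E′ i j k ∧ not (E i j k)

    T : ℕ
    T = ∑< τ

    -- On triples containing `x` only `E` contributes, on both sides. On the others, deletion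
    -- preserves emptiness, so `E′` splits into `E` and the newly empty triples of `τ`.
    balance : N△ P + T ≡ V P x + Nempty P (without x)
    balance = begin
      N△ P + T ≡⟨ cong (_+ T) (countTriples-∑ F n _) ⟩
      ∑< E + ∑< τ ≡⟨ ∑³-+ _ (λ i j k → χ (i ≺ j ∧ j ≺ k ∧ τ i j k)) ⟨
      ∑³ (λ i j k → χ (i ≺ j ∧ j ≺ k ∧ E i j k) + χ (i ≺ j ∧ j ≺ k ∧ τ i j k))
        ≡⟨ ∑³-cong (λ i j k → pointwise (i ≺ j) (j ≺ k) (does (i ≟ᶠ x)) (does (j ≟ᶠ x)) (does (k ≟ᶠ x)) _ _ (E⇒E′ i j k)) ⟩
      ∑³ (λ i j k → χ (i ≺ j ∧ j ≺ k ∧ has-x i j k ∧ E i j k) +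
        χ (i ≺ j ∧ j ≺ k ∧ (without x i ∧ without x j ∧ without x k ∧ E′ i j k)))
        ≡⟨ ∑³-+ (λ i j k → χ (i ≺ j ∧ j ≺ k ∧ has-x i j k ∧ E i j k)) _ ⟩
      ∑< (λ i j k → has-x i j k ∧ E i j k) + ∑< (λ i j k → without x i ∧ without x j ∧ without x k ∧ E′ i j k)
        ≡⟨ cong₂ _+_ (countTriples-∑ F n _) (countTriples-∑ F n _) ⟨
      V P x + Nempty P (without x) ∎
      where
      open ≡.≡-Reasoning
      pointwise : ∀ p q a b d e e′ → (e ≡ true → e′ ≡ true) →
        χ (p ∧ q ∧ e) + χ (p ∧ q ∧ not (a ∨ b ∨ d) ∧ e′ ∧ not e) ≡
        χ (p ∧ q ∧ (a ∨ b ∨ d) ∧ e) + χ (p ∧ q ∧ not a ∧ not b ∧ not d ∧ e′)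
      pointwise false _ _ _ _ _ _ _ = refl
      pointwise true false _ _ _ _ _ _ = refl
      pointwise true true true b d e e′ _ = refl
      pointwise true true false true d e e′ _ = refl
      pointwise true true false false true e e′ _ = refl
      pointwise true true false false false true e′ h rewrite h refl = refl
      pointwise true true false false false false true h = refl
      pointwise true true false false false false false h = refl

    -- The empty triangles at x become the arcs of a digraph, directed so that x lies to their left;
    -- a triangle counted by τ becomes a directed 3-cycle.
    D : Fin n → Fin n → Bool
    D a b = does (0# <? orient (P a) (P b) (P x)) ∧ E x a b

    D-pos : ∀ {a b} → 0# < orient (P a) (P b) (P x) → D a b ≡ E x a b
    D-pos {a} {b} p = cong (_∧ E x a b) (dec-true (0# <? orient (P a) (P b) (P x)) p)

    D-neg : ∀ {a b} → orient (P a) (P b) (P x) < 0# → D a b ≡ false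
    D-neg {a} {b} p = cong (_∧ E x a b) (dec-false (0# <? orient (P a) (P b) (P x)) (<-asym p))

    ¬D : ∀ {a b} → orient (P a) (P b) (P x) ≈ 0# → D a b ≡ false
    ¬D {a} {b} e = cong (_∧ E x a b) (dec-false (0# <? orient (P a) (P b) (P x)) (<-irrefl (≈-sym e)))

    loopless : ∀ a → D a a ≡ false
    loopless a = ¬D (orient-aab (P a) (P x))

    D-xʳ : ∀ a → D a x ≡ false
    D-xʳ a = ¬D (≈-trans (≈-sym (orient-rotate (P a) (P x) (P x))) (orient-aab (P x) (P a)))

    D-xˡ : ∀ b → D x b ≡ false
    D-xˡ b = ¬D (orient-aba (P x) (P b))

    U : Fin n → Fin n → Bool
    U a b = D a b ∨ D b a

    χ-U : ∀ a b → χ (U a b) ≡ χ (D a b) + χ (D b a)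
    χ-U a b = χ-∨ (D a b) (D b a) λ p q → <-asym (does-true (_ <? _) (proj₁ (∧-true p)))
      (orient-swap-pos (does-true (_ <? _) (proj₁ (∧-true q))))

    module LG = LineGraph D loopless
    module I = Incident x U (λ a b → Bool.∨-comm (D a b) (D b a))
      (λ a → cong₂ _∨_ (loopless a) (loopless a)) (λ b → cong₂ _∨_ (D-xˡ b) (D-xʳ b))

    ∑²-U : ∑² (λ a b → χ (U a b)) ≡ 2 * ∑² (λ a b → χ (D a b))
    ∑²-U = trans (∑²-cong χ-U) (trans (∑²-+ (λ a b → χ (D a b)) (λ a b → χ (D b a)))
      (cong (_+_ (∑² (λ a b → χ (D a b)))) (trans (∑-comm (λ a b → χ (D b a))) (≡.sym (ℕ.+-identityʳ _)))))

    module InGeneralPosition (gp : GeneralPosition P) where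

      E-U : ∀ {j k} → ¬ j ≡ x → ¬ k ≡ x → ¬ j ≡ k → E x j k ≡ U j k
      E-U {j} {k} j≢x k≢x j≢k = by-sign (compare 0# (orient (P j) (P k) (P x)))
        where
        by-sign : Tri (0# < orient (P j) (P k) (P x)) (0# ≈ orient (P j) (P k) (P x)) (orient (P j) (P k) (P x) < 0#) →
          E x j k ≡ U j k
        by-sign (tri≈ _ e _) = ⊥-elim (proj₂ gp j k x j≢k j≢x k≢x (≈-sym e))
        by-sign (tri< p _ _) = trans (≡.sym (Bool.∨-identityʳ (E x j k)))
          (cong₂ _∨_ (≡.sym (D-pos p)) (≡.sym (D-neg (orient-swap-pos p))))
        by-sign (tri> _ _ q) = trans (E-swap₂₃ x j k) (cong₂ _∨_ (≡.sym (D-neg q)) (≡.sym (D-pos (orient-swap-neg q))))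

      -- General position puts `x` strictly on one side of each line through two other points, so an
      -- empty triangle at `x` is exactly one arc. `U` records every arc in both orders, which
      -- cancels the 2 of `I.2*∑<v`.
      V-∑ : V P x ≡ ∑² (λ a b → χ (D a b))
      V-∑ = trans (countTriples-∑ F n _) (trans (∑<-cong λ {i} {j} {k} → distinct {i} {j} {k})
        (ℕ.*-cancelˡ-≡ _ _ 2 (trans I.2*∑<v ∑²-U)))
        where
        distinct : ∀ {i j k} → toℕ i ℕ.< toℕ j → toℕ j ℕ.< toℕ k → has-x i j k ∧ E i j k ≡ I.v i j k
        distinct i<j j<k = I.v-distinct E (E-swap₁₂ {allOf}) (E-rotate {allOf}) E-U (ℕ.<⇒≢ i<j ∘ cong toℕ)
          (ℕ.<⇒≢ (ℕ.<-trans i<j j<k) ∘ cong toℕ) (ℕ.<⇒≢ j<k ∘ cong toℕ)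

      V≤n² : V P x ≤ n * n
      V≤n² = begin
        V P x                   ≡⟨ V-∑ ⟩
        ∑² (λ a b → χ (D a b))  ≤⟨ (sum-mono λ a → sum-mono λ b → χ≤1 (D a b)) ⟩
        ∑² {n} (λ _ _ → 1)      ≡⟨ sum-const n (sum {n} (λ _ → 1)) ⟩
        n * sum {n} (λ _ → 1)   ≡⟨ cong (n *_) (trans (sum-const n 1) (ℕ.*-identityʳ n)) ⟩
        n * n                   ∎
        where
        open ℕ.≤-Reasoning
        χ≤1 : ∀ b → χ b ≤ 1
        χ≤1 true = ℕ.≤-refl
        χ≤1 false = z≤n

    τ-elim : ∀ {i j k} → τ i j k ≡ true →
      InTriangle (P i) (P j) (P k) (P x) × (∀ l → ¬ l ≡ x → ¬ InTriangle (P i) (P j) (P k) (P l))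
    τ-elim {i} {j} {k} t = inside , avoid
      where
      e : E′ i j k ∧ not (E i j k) ≡ true
      e = proj₂ (∧-true {not (has-x i j k)} t)
      avoid : ∀ l → ¬ l ≡ x → ¬ InTriangle (P i) (P j) (P k) (P l)
      avoid l l≢x = E-elim {without x} (proj₁ (∧-true e)) l (without-≢ l≢x)
      everywhere : ¬ InTriangle (P i) (P j) (P k) (P x) → ∀ l → allOf l ≡ true → ¬ InTriangle (P i) (P j) (P k) (P l)
      everywhere x∉ l _ with l ≟ᶠ x
      ... | yes refl = x∉
      ... | no l≢x = avoid l l≢x
      inside : InTriangle (P i) (P j) (P k) (P x)
      -- If `x` were outside, the triangle would already be empty before the deletion, contrary to
      -- `not (E i j k)`.
      inside = decidable-stable (inTriangle? (P i) (P j) (P k) (P x)) λ x∉ →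
        Bool.not-¬ (≡.sym (E-intro {allOf} {i} {j} {k} (everywhere x∉))) (≡.sym (proj₂ (∧-true {E′ i j k} e)))

    τ-intro : ∀ {i j k} → ¬ i ≡ x → ¬ j ≡ x → ¬ k ≡ x → InTriangle (P i) (P j) (P k) (P x) →
      (∀ l → ¬ l ≡ x → ¬ InTriangle (P i) (P j) (P k) (P l)) → τ i j k ≡ true
    τ-intro {i} {j} {k} i≢x j≢x k≢x inside avoid =
      cong₂ _∧_ (cong not (has-x-none {i} {j} {k} i≢x j≢x k≢x))
        (cong₂ (λ a b → a ∧ not b) (E-intro {without x} {i} {j} {k} λ l w → avoid l (≢-without w))
          (dec-false (emptyIn? P allOf i j k) λ e → All.lookup e (∈-allFin x) refl inside))

    τ-swap₁₂ : ∀ i j k → τ i j k ≡ τ j i k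
    τ-swap₁₂ i j k = cong₂ _∧_ (cong not (∨-swap (does (i ≟ᶠ x)) (does (j ≟ᶠ x)) _))
      (cong₂ (λ a b → a ∧ not b) (E-swap₁₂ {without x} i j k) (E-swap₁₂ {allOf} i j k))

    τ-swap₂₃ : ∀ i j k → τ i j k ≡ τ i k j
    τ-swap₂₃ i j k = cong₂ _∧_ (cong (λ b → not (does (i ≟ᶠ x) ∨ b)) (Bool.∨-comm (does (j ≟ᶠ x)) _))
      (cong₂ (λ a b → a ∧ not b) (E-swap₂₃ {without x} i j k) (E-swap₂₃ {allOf} i j k))

    τ-diagonal : ∀ i k → τ i i k ≡ false
    τ-diagonal i k = bool-≡ {τ i i k} {false} (λ t → ⊥-elim (degenerate (proj₁ (τ-elim {i} {i} {k} t)))) (λ ())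

    C : Fin n → Fin n → Fin n → ℕ
    C a b d = χ (D a b) * (χ (D b d) * χ (D d a))

    -- A point inside `xab` is inside `abd`, whose only interior point is `x`; but `x` is a vertex
    -- of `xab`.
    arc-of-nested : ∀ {a b d} → 0# < orient (P a) (P b) (P x) → 0# < orient (P b) (P d) (P x) →
      0# < orient (P d) (P a) (P x) → (∀ l → ¬ l ≡ x → ¬ InTriangle (P a) (P b) (P d) (P l)) → D a b ≡ true
    arc-of-nested {a} {b} {d} p q r avoid = cong₂ _∧_ (dec-true (0# <? orient (P a) (P b) (P x)) p)
      (E-intro {allOf} {x} {a} {b} nested)
      where
      nested : ∀ l → allOf l ≡ true → ¬ InTriangle (P x) (P a) (P b) (P l)
      nested l _ t with l ≟ᶠ x
      ... | yes refl = not-at-vertex t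
      ... | no l≢x = avoid l l≢x (inTriangle-nested p q r t)

    cycle-of : ∀ {a b d} → 0# < orient (P a) (P b) (P x) → 0# < orient (P b) (P d) (P x) →
      0# < orient (P d) (P a) (P x) → (∀ l → ¬ l ≡ x → ¬ InTriangle (P a) (P b) (P d) (P l)) → C a b d ≡ 1
    cycle-of {a} {b} {d} p q r avoid =
      cong₂ (λ u w → χ u * w) (arc-of-nested {a} {b} {d} p q r avoid)
        (cong₂ (λ u w → χ u * χ w) (arc-of-nested {b} {d} {a} q r p (λ l n → avoid l n ∘ inTriangle-rotate ∘ inTriangle-rotate))
          (arc-of-nested {d} {a} {b} r p q (λ l n → avoid l n ∘ inTriangle-rotate)))

    -- The common sign in `InTriangle` decides which of the two cyclic orders has `x` on the left of
    -- every side.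
    τ≤C : ∀ i j k → χ (τ i j k) ≤ C i j k + C i k j
    τ≤C i j k = χ-≤ (τ i j k) (λ t → by-sign (τ-elim {i} {j} {k} t))
      where
      χ-≤ : ∀ b {m} → (b ≡ true → 1 ≤ m) → χ b ≤ m
      χ-≤ true  h = h refl
      χ-≤ false _ = z≤n
      by-sign : InTriangle (P i) (P j) (P k) (P x) × (∀ l → ¬ l ≡ x → ¬ InTriangle (P i) (P j) (P k) (P l)) →
        1 ≤ C i j k + C i k j
      by-sign (inj₁ (p , q , r) , avoid) =
        ℕ.≤-trans (ℕ.≤-reflexive (≡.sym (cycle-of {i} {j} {k} p q r avoid))) (ℕ.m≤m+n _ _)
      by-sign (inj₂ (p , q , r) , avoid) = ℕ.≤-trans (ℕ.≤-reflexive (≡.sym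
        (cycle-of {i} {k} {j} (orient-swap-neg r) (orient-swap-neg q) (orient-swap-neg p)
          (λ l n → avoid l n ∘ inTriangle-swap ∘ inTriangle-rotate ∘ inTriangle-rotate)))) (ℕ.m≤n+m _ (C i j k))

    6T≤2cycles : 6 * T ≤ 2 * LG.cycles
    6T≤2cycles = begin
      6 * ∑< τ                             ≡⟨ ∑³-symmetric τ τ-swap₁₂ τ-swap₂₃ τ-diagonal ⟨
      ∑³ (λ i j k → χ (τ i j k))           ≤⟨ ∑³-mono τ≤C ⟩
      ∑³ (λ i j k → C i j k + C i k j)     ≡⟨ ∑³-+ C (λ i j k → C i k j) ⟩
      ∑³ C + ∑³ (λ i j k → C i k j)        ≡⟨ cong (_+_ (∑³ C)) (trans (∑³-swap₂₃ C) (≡.sym (ℕ.+-identityʳ (∑³ C)))) ⟩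
      2 * ∑³ C                             ∎
      where open ℕ.≤-Reasoning

    Δ≤V+H : GeneralPosition P → ∀ h → IsH (V P x) h → Δ P x ≤ V P x + h
    -- The chain is `6 * T ≤ 2 * LG.cycles ≤ 6 * h`, after which 6 is cancelled.
    Δ≤V+H gp h isH = ℕ.≤-trans (difference-≤ {N△ P} {Nempty P (without x)} {T} {V P x} balance) (ℕ.+-monoʳ-≤ (V P x)
      (ℕ.*-cancelˡ-≤ 6 (ℕ.≤-trans 6T≤2cycles (LG.cycles-IsH (subst (λ m → IsH m h) (InGeneralPosition.V-∑ gp) isH)))))

-- The lower bound: a parabola and an apex above it.

block-≤-sum : ∀ n off len {d} (f : Fin n → ℕ) → off + len ≤ n →
  (∀ i → off ≤ toℕ i → toℕ i ℕ.< off + len → d ≤ f i) → len * d ≤ sum f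
block-≤-sum n zero zero f _ _ = z≤n
block-≤-sum (suc n) zero (suc len) f (s≤s le) h =
  ℕ.+-mono-≤ (h zero z≤n (s≤s z≤n)) (block-≤-sum n zero len (f ∘ suc) le λ i _ lt → h (suc i) z≤n (s≤s lt))
block-≤-sum (suc n) (suc off) len f (s≤s le) h =
  ℕ.≤-trans (block-≤-sum n off len (f ∘ suc) le λ i ge lt → h (suc i) (s≤s ge) (s≤s lt)) (ℕ.m≤n+m _ (f zero))

-- The blocks are disjoint and in increasing order, so each choice of one index per block is an
-- increasing triple. The left side is the unfolded `k ^ 3`.
blocks-≤-∑< : ∀ {n} k a b d (t : Fin n → Fin n → Fin n → Bool) →
  a + k ≤ b → b + k ≤ d → d + k ≤ n →
  (∀ i j l → a ≤ toℕ i → toℕ i ℕ.< a + k → b ≤ toℕ j → toℕ j ℕ.< b + k → d ≤ toℕ l → t i j l ≡ true) →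
  k * (k * (k * 1)) ≤ ∑< t
blocks-≤-∑< {n} k a b d t a+k≤b b+k≤d d+k≤n h =
  block-≤-sum n a k (λ i → sum λ j → sum λ l → f i j l) (≤-trans³ a+k≤b b+k≤d d+k≤n) λ i a≤i i<a+k →
  block-≤-sum n b k (λ j → sum λ l → f i j l) (ℕ.≤-trans b+k≤d (ℕ.≤-trans (ℕ.m≤m+n d k) d+k≤n)) λ j b≤j j<b+k →
  block-≤-sum n d k (λ l → f i j l) d+k≤n λ l d≤l _ →
  ℕ.≤-reflexive (≡.sym (cong χ (cong₂ _∧_
    (dec-true (toℕ i ℕ.<? toℕ j) (ℕ.<-≤-trans i<a+k (ℕ.≤-trans a+k≤b b≤j)))
    (cong₂ _∧_ (dec-true (toℕ j ℕ.<? toℕ l) (ℕ.<-≤-trans j<b+k (ℕ.≤-trans b+k≤d d≤l)))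
      (h i j l a≤i i<a+k b≤j j<b+k d≤l)))))
  where
  f : Fin n → Fin n → Fin n → ℕ
  f i j l = χ (i ≺ j ∧ j ≺ l ∧ t i j l)
  ≤-trans³ : a + k ≤ b → b + k ≤ d → d + k ≤ n → a + k ≤ n
  ≤-trans³ p q r = ℕ.≤-trans p (ℕ.≤-trans (ℕ.m≤m+n b k) (ℕ.≤-trans q (ℕ.≤-trans (ℕ.m≤m+n d k) r)))

-- This and the next three identities supply the parities that separate `height` from `level` and
-- the apex from the parabola.
level-even : ∀ i j k → 2 * ((i + j) * (8 * k)) ≡ (2 * i + 2 * j) * (8 * k)
level-even = solve-∀

height-odd : ∀ i j k → suc (84 * (k * k)) + (2 * i) * (2 * j) ≡ suc (2 * (42 * (k * k) + i * (2 * j)))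
height-odd = solve-∀

square-even : ∀ j → 2 * (j * (2 * j)) ≡ (2 * j) * (2 * j)
square-even = solve-∀

apex-odd : (k : ℕ) → _≡_ {A = ℕ} (suc (84 * (k * k))) (suc (2 * (42 * (k * k))))
apex-odd k = cong suc (ℕ.*-assoc 2 42 (k * k))

height-AB : ∀ i b e → suc (84 * ((b + e) * (b + e))) + (2 * i) * (2 * (4 * (b + e) + b)) ≡
  suc ((2 * i + 2 * (4 * (b + e) + b)) * (8 * (b + e)) + (4 * ((b + e) * (b + e)) + 4 * (i * b) + 16 * ((b + e) * e)))
height-AB = solve-∀

height-BC : ∀ k b c → suc (84 * (k * k)) + (2 * (4 * k + b)) * (2 * (6 * k + c)) ≡
  suc ((2 * (4 * k + b) + 2 * (6 * k + c)) * (8 * k) + (20 * (k * k) + 8 * (k * b) + 4 * (b * c)))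
height-BC = solve-∀

height-AC : ∀ i d c → (2 * i + 2 * (6 * suc (i + d) + c)) * (8 * suc (i + d)) ≡
  suc (suc (84 * (suc (i + d) * suc (i + d))) + (2 * i) * (2 * (6 * suc (i + d) + c)) +
    (2 + 8 * (i + d) + 4 * ((i + d) * (i + d)) + 8 * (suc (i + d) * suc d) + 12 * (suc (i + d) * c) + 4 * (c * suc d)))
height-AC = solve-∀

module Parabola {c ℓ₁ ℓ₂} (F : OrderedField c ℓ₁ ℓ₂) (k : ℕ) where
  open OrderedField F hiding (zero)
    renaming ( _<_ to infix 4 _<_; _+_ to _+ᶠ_; _*_ to _*ᶠ_; _-_ to _-ᶠ_
             ; refl to ≈-refl; sym to ≈-sym; trans to ≈-trans)
  open Geometry F
  open Field F
  open Plane F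

  onParabola : Carrier → Point
  onParabola s = s , s *ᶠ s

  -- This is the Vandermonde determinant of `s`, `t`, `u`.
  orient-parabola : ∀ s t u → orient (onParabola s) (onParabola t) (onParabola u) ≈
    ((t -ᶠ s) *ᶠ (u -ᶠ s)) *ᶠ (u -ᶠ t)
  orient-parabola = solve 3 (λ s t u →
    (t :- s) :* (u :* u :- s :* s) :- (t :* t :- s :* s) :* (u :- s) :=
    ((t :- s) :* (u :- s)) :* (u :- t)) ≈-refl

  -- The chord has equation y = (s + t) x - s t; the second factor is the height of `(p , q)` above
  -- it.
  orient-chord : ∀ s t p q → orient (onParabola s) (onParabola t) (p , q) ≈
    (t -ᶠ s) *ᶠ ((q +ᶠ (s *ᶠ t)) -ᶠ ((s +ᶠ t) *ᶠ p))
  orient-chord = solve 4 (λ s t p q →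
    (t :- s) :* (q :- s :* s) :- (t :* t :- s :* s) :* (p :- s) :=
    (t :- s) :* ((q :+ (s :* t)) :- ((s :+ t) :* p))) ≈-refl

  -- Even parameters keep the apex off every chord, by parity.
  pt : ℕ → Point
  pt i = onParabola (ι (2 * i))

  -- The apex is 20k² + 1 above the parabola. The product (8k - 2i)(2j - 8k) is at most 16k² for the
  -- first two blocks and exceeds 24k² for the first and third; 20 lies between. The 1 makes the
  -- ordinate odd.
  apex : Point
  apex = ι (8 * k) , ι (suc (84 * (k * k)))

  -- height i j − level i j = (2i − 8k)(2j − 8k) + 20k² + 1 is odd, so never zero. It is positive when
  -- i < k and 4k ≤ j < 5k or when 4k ≤ i and 6k ≤ j, and negative when i < k and 6k ≤ j.
  height level : ℕ → ℕ → ℕ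
  height i j = suc (84 * (k * k)) + (2 * i) * (2 * j)
  level i j = (2 * i + 2 * j) * (8 * k)

  height≢level : ∀ i j → ¬ height i j ≡ level i j
  height≢level i j e = ℕ.even≢odd ((i + j) * (8 * k)) (42 * (k * k) + i * (2 * j))
    (trans (level-even i j k) (trans (≡.sym e) (height-odd i j k)))

  orient-apex : ∀ i j → orient (pt i) (pt j) apex ≈
    (ι (2 * j) -ᶠ ι (2 * i)) *ᶠ (ι (height i j) -ᶠ ι (level i j))
  orient-apex i j = ≈-trans (orient-chord _ _ _ _) (*-congˡ (sub-cong
    (≈-sym (≈-trans (ι-+ (suc (84 * (k * k))) _) (+-congˡ (ι-* (2 * i) (2 * j)))))
    (≈-sym (≈-trans (ι-* (2 * i + 2 * j) (8 * k)) (*-congʳ (ι-+ (2 * i) (2 * j)))))))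

  step-pos : ∀ {i j} → i ℕ.< j → 0# < ι (2 * j) -ᶠ ι (2 * i)
  step-pos i<j = sub-pos (ι-mono (ℕ.*-monoʳ-< 2 i<j))

  convex : ∀ {i j l} → i ℕ.< j → j ℕ.< l → 0# < orient (pt i) (pt j) (pt l)
  convex i<j j<l = <-respʳ (≈-sym (orient-parabola _ _ _))
    (*-pos (*-pos (step-pos i<j) (step-pos (ℕ.<-trans i<j j<l))) (step-pos j<l))

  apex-above : ∀ {i j} → i ℕ.< j → level i j ℕ.< height i j → 0# < orient (pt i) (pt j) apex
  apex-above {i} {j} i<j lt = <-respʳ (≈-sym (orient-apex i j)) (*-pos (step-pos i<j) (sub-pos (ι-mono lt)))

  apex-below : ∀ {i j} → i ℕ.< j → height i j ℕ.< level i j → orient (pt i) (pt j) apex < 0#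
  apex-below {i} {j} i<j lt = <-respˡ (≈-sym (orient-apex i j))
    (*-pos-neg (step-pos i<j) (<-respˡ flip (neg-neg (sub-pos (ι-mono lt)))))
    where
    flip : ∀ {u v} → - (u -ᶠ v) ≈ v -ᶠ u
    flip {u} {v} = solve 2 (λ u v → :- (u :- v) := v :- u) ≈-refl u v

  *-nonzero : ∀ {u v} → ¬ u ≈ 0# → ¬ v ≈ 0# → ¬ u *ᶠ v ≈ 0#
  *-nonzero {u} {v} u≉0 v≉0 uv≈0 with inverse u u≉0
  ... | w , uw≈1 = v≉0 (≈-trans (≈-sym (*-identityˡ v)) (≈-trans (*-congʳ (≈-sym uw≈1))
    (≈-trans (solve 3 (λ u w v → (u :* w) :* v := w :* (u :* v)) ≈-refl u w v) (≈-trans (*-congˡ uv≈0) (zeroʳ w)))))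

  ι-sub-nonzero : ∀ {m n} → ¬ m ≡ n → ¬ ι m -ᶠ ι n ≈ 0#
  ι-sub-nonzero m≢n e = m≢n (ι-injective (Algebra.Properties.Group.x∙y⁻¹≈ε⇒x≈y +-group _ _ e))

  step-nonzero : ∀ {i j} → ¬ i ≡ j → ¬ ι (2 * j) -ᶠ ι (2 * i) ≈ 0#
  step-nonzero i≢j = ι-sub-nonzero (i≢j ∘ ≡.sym ∘ ℕ.*-cancelˡ-≡ _ _ 2)

  pt-general : ∀ {i j l} → ¬ i ≡ j → ¬ i ≡ l → ¬ j ≡ l → ¬ orient (pt i) (pt j) (pt l) ≈ 0#
  pt-general i≢j i≢l j≢l e = *-nonzero (*-nonzero (step-nonzero i≢j) (step-nonzero i≢l)) (step-nonzero j≢l)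
    (≈-trans (≈-sym (orient-parabola _ _ _)) e)

  apex-general : ∀ {i j} → ¬ i ≡ j → ¬ orient (pt i) (pt j) apex ≈ 0#
  apex-general {i} {j} i≢j e = *-nonzero (step-nonzero i≢j) (ι-sub-nonzero (height≢level i j))
    (≈-trans (≈-sym (orient-apex i j)) e)

  apex≢pt : ∀ j → ι (suc (84 * (k * k))) ≈ ι (2 * j) *ᶠ ι (2 * j) → ⊥
  apex≢pt j e = ℕ.even≢odd (j * (2 * j)) (42 * (k * k))
    (trans (square-even j) (trans (≡.sym (ι-injective (≈-trans e (≈-sym (ι-* (2 * j) (2 * j)))))) (apex-odd k)))

  module _ {n : ℕ} where
    P : Fin (suc n) → Point
    P zero    = apex
    P (suc i) = pt (toℕ i)

    P-injective : ∀ i j → px (P i) ≈ px (P j) → py (P i) ≈ py (P j) → i ≡ j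
    P-injective zero zero _ _ = refl
    P-injective zero (suc j) _ q = ⊥-elim (apex≢pt (toℕ j) q)
    P-injective (suc i) zero _ q = ⊥-elim (apex≢pt (toℕ i) (≈-sym q))
    P-injective (suc i) (suc j) p _ =
      cong suc (Fin.toℕ-injective (ℕ.*-cancelˡ-≡ _ _ 2 (ι-injective p)))

    P-general : ∀ i j l → ¬ i ≡ j → ¬ i ≡ l → ¬ j ≡ l → ¬ orient (P i) (P j) (P l) ≈ 0#
    P-general zero zero _ i≢j _ _ _ = i≢j refl
    P-general zero (suc _) zero _ i≢l _ _ = i≢l refl
    P-general (suc _) zero zero _ _ j≢l _ = j≢l refl
    P-general zero (suc j) (suc l) _ _ j≢l e =
      apex-general (j≢l ∘ cong suc ∘ Fin.toℕ-injective) (≈-trans (orient-rotate apex (pt (toℕ j)) (pt (toℕ l))) e)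
    P-general (suc i) zero (suc l) _ i≢l _ e =
      apex-general (i≢l ∘ ≡.sym ∘ cong suc ∘ Fin.toℕ-injective)
        (≈-trans (≈-sym (orient-rotate (pt (toℕ l)) (pt (toℕ i)) apex)) e)
    P-general (suc i) (suc j) zero i≢j _ _ = apex-general (i≢j ∘ cong suc ∘ Fin.toℕ-injective)
    P-general (suc i) (suc j) (suc l) i≢j i≢l j≢l =
      pt-general (i≢j ∘ cong suc ∘ Fin.toℕ-injective) (i≢l ∘ cong suc ∘ Fin.toℕ-injective)
        (j≢l ∘ cong suc ∘ Fin.toℕ-injective)

    general-position : GeneralPosition P
    general-position = P-injective , P-general

  orient-rotate-pos : ∀ {a b d} → 0# < orient a b d → 0# < orient b d a
  orient-rotate-pos {a} {b} {d} = <-respʳ (≈-sym (orient-rotate a b d))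

  mixed₁₂ : ∀ {a b d p} → 0# < orient a b p → orient b d p < 0# → ¬ InTriangle a b d p
  mixed₁₂ p q (inj₁ (_ , q' , _)) = <-asym q q'
  mixed₁₂ p q (inj₂ (p' , _)) = <-asym p p'

  mixed₂₃ : ∀ {a b d p} → 0# < orient b d p → orient d a p < 0# → ¬ InTriangle a b d p
  mixed₂₃ p q t = mixed₁₂ p q (inTriangle-rotate t)

  mixed₁₃ : ∀ {a b d p} → orient a b p < 0# → 0# < orient b d p → ¬ InTriangle a b d p
  mixed₁₃ p q (inj₁ (p' , _)) = <-asym p p'
  mixed₁₃ p q (inj₂ (_ , q' , _)) = <-asym q q'

  -- Convex position: for `l` in any of the four gaps left by `i`, `j`, `m`, two sides of the
  -- triangle see the point with opposite signs. Otherwise it is a vertex.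
  pt-empty : ∀ {i j m} l → i ℕ.< j → j ℕ.< m → ¬ InTriangle (pt i) (pt j) (pt m) (pt l)
  pt-empty {i} {j} {m} l i<j j<m with ℕ.<-cmp l i | ℕ.<-cmp l j | ℕ.<-cmp l m
  ... | tri≈ _ refl _ | _ | _ = not-at-vertex
  ... | tri< l<i _ _ | _ | _ = mixed₂₃ (orient-rotate-pos (convex (ℕ.<-trans l<i i<j) j<m))
        (orient-swap-pos (orient-rotate-pos (convex l<i (ℕ.<-trans i<j j<m))))
  ... | tri> _ _ i<l | tri< l<j _ _ | _ = mixed₁₃
        (orient-swap-pos {a = pt j} (orient-rotate-pos (orient-rotate-pos (convex i<l l<j))))
        (orient-rotate-pos (convex l<j j<m))
  ... | tri> _ _ _ | tri≈ _ refl _ | _ = not-at-vertex ∘ inTriangle-rotate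
  ... | tri> _ _ _ | tri> _ _ j<l | tri< l<m _ _ = mixed₁₂ (convex i<j j<l)
        (orient-swap-pos {a = pt m} (orient-rotate-pos (orient-rotate-pos (convex j<l l<m))))
  ... | tri> _ _ _ | tri> _ _ _ | tri≈ _ refl _ = not-at-vertex ∘ inTriangle-rotate ∘ inTriangle-rotate
  ... | tri> _ _ _ | tri> _ _ j<l | tri> _ _ m<l = mixed₂₃ (convex j<m m<l)
        (orient-swap-pos (convex (ℕ.<-trans i<j j<m) m<l))

module _ (k : ℕ) where

  height-level-AB : ∀ {i j} → 4 * k ≤ j → j ℕ.< 4 * k + k →
    (2 * i + 2 * j) * (8 * k) ℕ.< suc (84 * (k * k)) + (2 * i) * (2 * j)
  height-level-AB {i} {j} 4k≤j j<5k with ℕ.m≤n⇒∃[o]m+o≡n 4k≤j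
  ... | b , refl with ℕ.m≤n⇒∃[o]m+o≡n (ℕ.<⇒≤ (ℕ.+-cancelˡ-< (4 * k) b k j<5k))
  ... | e , refl = subst ((2 * i + 2 * (4 * (b + e) + b)) * (8 * (b + e)) ℕ.<_)
    (≡.sym (height-AB i b e)) (s≤s (ℕ.m≤m+n _ _))

  height-level-BC : ∀ {j l} → 4 * k ≤ j → 6 * k ≤ l →
    (2 * j + 2 * l) * (8 * k) ℕ.< suc (84 * (k * k)) + (2 * j) * (2 * l)
  height-level-BC 4k≤j 6k≤l with ℕ.m≤n⇒∃[o]m+o≡n 4k≤j | ℕ.m≤n⇒∃[o]m+o≡n 6k≤l
  ... | b , refl | d , refl = subst ((2 * (4 * k + b) + 2 * (6 * k + d)) * (8 * k) ℕ.<_)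
    (≡.sym (height-BC k b d)) (s≤s (ℕ.m≤m+n _ _))

  height-level-AC : ∀ {i l} → i ℕ.< k → 6 * k ≤ l →
    suc (84 * (k * k)) + (2 * i) * (2 * l) ℕ.< (2 * i + 2 * l) * (8 * k)
  height-level-AC {i} i<k 6k≤l with ℕ.m≤n⇒∃[o]m+o≡n i<k
  ... | e , refl with ℕ.m≤n⇒∃[o]m+o≡n 6k≤l
  ... | d , refl = subst (suc (84 * (suc (i + e) * suc (i + e))) + (2 * i) * (2 * (6 * suc (i + e) + d)) ℕ.<_)
    (≡.sym (height-AC i e d)) (s≤s (ℕ.m≤m+n _ _))

module Extremal {c ℓ₁ ℓ₂} (F : OrderedField c ℓ₁ ℓ₂) (k n : ℕ) where
  open OrderedField F using (0#)
  open Geometry F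
  open Field F using (<-asym)
  open Plane F
  module Par = Parabola F k
  open Par using (pt; apex; apex-above; apex-below; pt-empty; height; level)
  open Configuration F

  P : Fin (suc n) → Point
  P = Par.P {n}

  open Empty P zero
  open InGeneralPosition Par.general-position using (V≤n²) public

  avoid : ∀ {i j l : Fin n} → toℕ i ℕ.< toℕ j → toℕ j ℕ.< toℕ l →
    ∀ m → ¬ m ≡ zero → ¬ InTriangle (P (suc i)) (P (suc j)) (P (suc l)) (P m)
  avoid i<j j<l zero    m≢0 = ⊥-elim (m≢0 refl)
  avoid i<j j<l (suc m) _   = pt-empty (toℕ m) i<j j<l

  k³≤T : 7 * k ≤ n → k * (k * (k * 1)) ≤ T
  -- The parameter blocks start at 0, 4k and 6k. The offsets are larger by one because index `zero`
  -- is the apex.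
  k³≤T 7k≤n = blocks-≤-∑< k 1 (suc (4 * k)) (suc (6 * k)) τ (s≤s (ℕ.m≤m+n k _))
    (s≤s (ℕ.≤-trans (ℕ.≤-reflexive (ℕ.+-comm (4 * k) k)) (ℕ.*-monoˡ-≤ k (ℕ.n≤1+n 5))))
    (s≤s (ℕ.≤-trans (ℕ.≤-reflexive (ℕ.+-comm (6 * k) k)) 7k≤n)) counted
    where
    counted : ∀ i j l → 1 ≤ toℕ i → toℕ i ℕ.< 1 + k → suc (4 * k) ≤ toℕ j → toℕ j ℕ.< suc (4 * k) + k →
      suc (6 * k) ≤ toℕ l → τ i j l ≡ true
    counted (suc i) (suc j) (suc l) _ (s≤s i<k) (s≤s 4k≤j) (s≤s j<5k) (s≤s 6k≤l) =
      τ-intro {suc i} {suc j} {suc l} (λ ()) (λ ()) (λ ())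
        (inj₁ ( apex-above i<j (height-level-AB k {toℕ i} 4k≤j j<5k)
              , apex-above j<l (height-level-BC k 4k≤j 6k≤l)
              , orient-swap-neg (apex-below (ℕ.<-trans i<j j<l) (height-level-AC k i<k 6k≤l))))
        (avoid i<j j<l)
      where
      i<j : toℕ i ℕ.< toℕ j
      i<j = ℕ.<-≤-trans i<k (ℕ.≤-trans (ℕ.m≤m+n k _) 4k≤j)
      j<l : toℕ j ℕ.< toℕ l
      j<l = ℕ.<-≤-trans j<5k (ℕ.≤-trans (ℕ.≤-trans (ℕ.≤-reflexive (ℕ.+-comm (4 * k) k))
        (ℕ.*-monoˡ-≤ k (ℕ.n≤1+n 5))) 6k≤l)

module Degenerate {c ℓ₁ ℓ₂} (F : OrderedField c ℓ₁ ℓ₂) (n : ℕ) where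
  open Geometry F
  open Field F using (<-asym)
  open Plane F
  open OrderedField F using (0#) renaming (_<_ to infix 4 _<_)
  open Parabola F 0 using (pt; apex; apex-above; height)
  open Extremal F 0 n
  open Configuration F
  open Empty P zero

  -- For `k = 0` the apex is (0, 1) and every `level` is 0, so the apex is above all chords and
  -- inside no triangle.
  T≡0 : T ≡ 0
  T≡0 = ∑<-zero λ {i} {j} {l} i<j j<l → Bool.¬-not λ t → absurd i<j j<l (proj₁ (τ-elim {i} {j} {l} t))
    where
    above : ∀ {i j} → i ℕ.< j → 0# < orient (pt i) (pt j) apex
    above {i} {j} i<j = apex-above i<j
      (subst (ℕ._< height i j) (≡.sym (ℕ.*-zeroʳ (2 * i + 2 * j))) (s≤s z≤n))
    absurd : ∀ {i j l : Fin (suc n)} → toℕ i ℕ.< toℕ j → toℕ j ℕ.< toℕ l → ¬ InTriangle (P i) (P j) (P l) (P zero)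
    absurd {zero} _ _ inside = not-at-vertex inside
    absurd {suc i} {suc j} {suc l} (s≤s i<j) (s≤s j<l) (inj₁ (_ , _ , p)) =
      <-asym p (orient-swap-pos (above (ℕ.<-trans i<j j<l)))
    absurd {suc i} {suc j} {suc l} (s≤s i<j) (s≤s j<l) (inj₂ (p , _)) = <-asym p (above i<j)

-- Constants, and the choice of the number of points.

scaled-≤ : ∀ a b → a ≤ b * 1048576 →
  ((+ 1 / 1024) *ℚ (+ 1 / 1024)) *ℚ (+ a / 1) ≤ℚ (+ b / 1)
scaled-≤ a b a≤ = ℚ.toℚᵘ-cancel-≤ (ℚᵘ.≤-respˡ-≃ (ℚᵘ.≃-sym scaled)
  (ℚᵘ.≤-respʳ-≃ (ℚᵘ.≃-sym (ℚ.toℚᵘ-fromℚᵘ (ℚᵘ.mkℚᵘ (+ b) 0)))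
    (ℚᵘ.*≤* (subst₂ ℤ._≤_ left right (ℤ.+≤+ a≤)))))
  where
  ε : ℚᵘ.ℚᵘ
  -- `mkℚᵘ` takes the denominator minus one, so this is 1 / 1024².
  ε = ℚᵘ.mkℚᵘ (+ 1) 1048575
  scaled : toℚᵘ (((+ 1 / 1024) *ℚ (+ 1 / 1024)) *ℚ (+ a / 1)) ℚᵘ.≃ ε ℚᵘ.* ℚᵘ.mkℚᵘ (+ a) 0
  scaled = ℚᵘ.≃-trans (ℚ.toℚᵘ-homo-* ((+ 1 / 1024) *ℚ (+ 1 / 1024)) (+ a / 1))
    (ℚᵘ.*-cong {ε} ℚᵘ.≃-refl (ℚ.toℚᵘ-fromℚᵘ (ℚᵘ.mkℚᵘ (+ a) 0)))
  left : + a ≡ (+ 1 ℤ.* + a) ℤ.* + 1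
  left = ≡.sym (trans (ℤ.*-identityʳ _) (ℤ.*-identityˡ (+ a)))
  right : + (b * 1048576) ≡ + b ℤ.* + 1048576
  right = ℤ.pos-* b 1048576

module _ (c k v δ : ℕ) where

  -- The constant is the right factor: as the left one it would be unfolded by recursion once it
  -- is a large literal.
  cubic-bound : c * 2 ≤ k → v ≤ c * (k * k) → k * (k * (k * 1)) ≤ δ + v → v ^ 3 ≤ δ ^ 2 * (c * c * c * 4)
  cubic-bound 2c≤k v≤ k³≤ = begin
    v ^ 3                           ≤⟨ ℕ.^-monoˡ-≤ 3 v≤ ⟩
    (c * (k * k)) ^ 3               ≡⟨ sextic c k ⟩
    c * c * c * (k ^ 3) ^ 2         ≤⟨ ℕ.*-monoʳ-≤ (c * c * c) (ℕ.^-monoˡ-≤ 2 k³≤2δ) ⟩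
    c * c * c * (2 * δ) ^ 2         ≡⟨ quadratic (c * c * c) δ ⟩
    δ ^ 2 * (c * c * c * 4)         ∎
    where
    open ℕ.≤-Reasoning
    sextic : ∀ c k → c * (k * k) * (c * (k * k) * (c * (k * k) * 1)) ≡
      c * c * c * (k * (k * (k * 1)) * (k * (k * (k * 1)) * 1))
    sextic = solve-∀
    quadratic : ∀ c δ → c * (2 * δ * (2 * δ * 1)) ≡ δ * (δ * 1) * (c * 4)
    quadratic = solve-∀
    -- The hypothesis `k³ ≤ δ + v` is doubled, and 2v ≤ 2ck² ≤ k³ is then cancelled.
    k³≤2δ : k ^ 3 ≤ 2 * δ
    k³≤2δ = ℕ.+-cancelʳ-≤ (k ^ 3) _ _ (begin
      k ^ 3 + k ^ 3                           ≤⟨ ℕ.+-mono-≤ k³≤ k³≤ ⟩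
      (δ + v) + (δ + v)                       ≤⟨ ℕ.+-mono-≤ (ℕ.+-monoʳ-≤ δ v≤) (ℕ.+-monoʳ-≤ δ v≤) ⟩
      (δ + c * (k * k)) + (δ + c * (k * k))   ≡⟨ collect c δ k ⟩
      2 * δ + (c * 2) * (k * (k * 1))         ≤⟨ ℕ.+-monoʳ-≤ (2 * δ) (ℕ.*-monoˡ-≤ (k * (k * 1)) 2c≤k) ⟩
      2 * δ + k ^ 3                           ∎)
      where
      collect : ∀ c δ k → (δ + c * (k * k)) + (δ + c * (k * k)) ≡ 2 * δ + (c * 2) * (k * (k * 1))
      collect = solve-∀

module LowerBound {c ℓ₁ ℓ₂} (F : OrderedField c ℓ₁ ℓ₂) where
  open Geometry F
  open Configuration F

  -- Here `c = 64`, since V is at most (8k)² = 64k²; thus 128 is 2 · 64 and 1048576 is 64³ · 4.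
  many-points : ∀ n k → 128 ≤ k → 7 * k ≤ n → suc n ≤ 8 * k →
    let P = Extremal.P F k n in V P zero ^ 3 ≤ Δ P zero ^ 2 * 1048576
  many-points n k 128≤k 7k≤n n<8k = cubic-bound 64 k (V P zero) (Δ P zero) 128≤k
    (ℕ.≤-trans V≤n² (ℕ.≤-trans (ℕ.*-mono-≤ n<8k n<8k) (ℕ.≤-reflexive (square 8 k))))
    (ℕ.≤-trans (k³≤T 7k≤n) (≤-difference {N△ P} {Nempty P (without zero)} {T} {V P zero} balance))
    where
    open Extremal F k n
    open Empty P zero
    square : ∀ c k → c * k * (c * k) ≡ c * c * (k * k)
    square = solve-∀

  -- With T = 0 the balance gives V ≤ Δ, and one of the three factors V is bounded by 1024².
  few-points : ∀ n → suc n ≤ 1024 → let P = Extremal.P F 0 n in V P zero ^ 3 ≤ Δ P zero ^ 2 * 1048576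
  few-points n n<1024 = ℕ.≤-trans (ℕ.≤-reflexive (ℕ.*-comm (V P zero) (V P zero ^ 2)))
    (ℕ.*-mono-≤ (ℕ.^-monoˡ-≤ 2 V≤Δ) (ℕ.≤-trans V≤n² (ℕ.*-mono-≤ n<1024 n<1024)))
    where
    open Extremal F 0 n
    open Empty P zero
    V≤Δ : V P zero ≤ Δ P zero
    V≤Δ = subst (V P zero ≤_) (trans (cong (_+_ (Δ P zero)) (Degenerate.T≡0 F n)) (ℕ.+-identityʳ (Δ P zero)))
      (≤-difference′ {N△ P} {Nempty P (without zero)} {T} {V P zero} balance)

  extremal : ∀ n → ∃[ P ] (GeneralPosition {suc n} P × ∃[ x ] V P x ^ 3 ≤ Δ P x ^ 2 * 1048576)
  extremal n with 128 ℕ.≤? n ℕ./ 7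
  ... | yes 128≤k = Extremal.P F k n , Parabola.general-position F k , zero ,
      many-points n k 128≤k (ℕ.≤-trans (ℕ.≤-reflexive (ℕ.*-comm 7 k)) (m/n*n≤m n 7)) n<8k
    where
    k : ℕ
    k = n ℕ./ 7
    open ℕ.≤-Reasoning
    n<8k : suc n ≤ 8 * k
    n<8k = begin
      suc n                  ≡⟨ cong suc (m≡m%n+[m/n]*n n 7) ⟩
      suc (n ℕ.% 7) + k * 7  ≤⟨ ℕ.+-mono-≤ (m%n<n n 7) (ℕ.≤-reflexive (ℕ.*-comm k 7)) ⟩
      -- The remainder of `n` and the extra point amount to at most 7, which is below 128 ≤ k.
      7 + 7 * k              ≤⟨ ℕ.+-monoˡ-≤ (7 * k) (ℕ.≤-trans (ℕ.m≤m+n 7 121) 128≤k) ⟩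
      8 * k                  ∎
  ... | no 128≰k = Extremal.P F 0 n , Parabola.general-position F 0 , zero , few-points n n<1024
    where
    open ℕ.≤-Reasoning
    n<1024 : suc n ≤ 1024
    n<1024 = begin
      suc n                            ≡⟨ cong suc (m≡m%n+[m/n]*n n 7) ⟩
      suc (n ℕ.% 7) + (n ℕ./ 7) * 7    ≤⟨ ℕ.+-mono-≤ (m%n<n n 7) (ℕ.*-monoˡ-≤ 7 (ℕ.<⇒≤ (ℕ.≰⇒> 128≰k))) ⟩
      7 + 128 * 7                      ≤⟨ ℕ.m≤m+n 903 121 ⟩
      1024                             ∎

theorem1 : ∀ {c ℓ₁ ℓ₂} (F : OrderedField c ℓ₁ ℓ₂) → let open Geometry F in
    (∀ (n : ℕ) (P : Fin n → Point) → GeneralPosition P → (x : Fin n) →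
    ∀ h → IsH (V P x) h → Δ P x ≤ V P x + h) ×
    (∃[ C ] (0ℚ <ℚ C ×
    (∀ (n : ℕ) → ∃[ P ] (GeneralPosition {suc n} P × ∃[ x ]
    ((C *ℚ C) *ℚ (+ (V P x ^ 3) / 1) ≤ℚ (+ (Δ P x ^ 2) / 1))))))
theorem1 F =
    (λ n P general x → Configuration.Empty.Δ≤V+H F P x general)
  -- The exponent 3/2 is cleared by squaring, so the constant enters as C² = 1 / 1048576.
  , + 1 / 1024 , *<* (ℤ.+<+ (s≤s z≤n))
  , λ n → let (P , general , x , bound) = LowerBound.extremal F n
          in P , general , x , scaled-≤ (V P x ^ 3) (Δ P x ^ 2) bound
  where open Geometry F
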